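{- There is an absolute constant $C>0$ such that for every $n\ge 2$, every axis-aligned rectangle $R$ in the plane and every noncorectilinear set $P$ of $n$ points in the interior of $R$, the diameter of the graph of rectangulations $G(P)$ is at most $C\,n\log n$. (That is, the diameter of $G(P)$ is $O(n\log n)$.)
   Context: A finite point set in the plane is noncorectilinear if its points have pairwise distinct $x$-coordinates and pairwise distinct $y$-coordinates. Let $P$ be a noncorectilinear set of $n$ points in the interior of an axis-aligned rectangle $R$. A rectangulation of $P$ (within $R$) is a subdivision of $R$ into rectangles by exactly $n$ pairwise noncrossing axis-parallel (horizontal or vertical) line segments, each containing exactly one point of $P$, this point lying in the relative interior of the segment. (So each endpoint of a segment lies on the boundary of $R$ or in the relative interior of an orthogonal segment.) Flip$(r,p)$: let $r$ be a rectangulation of $P$ and $p\in P$ such that the segment $s$ containing $p$ does not contain any endpoints of other segments. The operation changes the orientation of $s$ from vertical to horizontal or vice versa (replacing $s$ by the orthogonal segment through $p$ that extends in both directions until it reaches another segment or the boundary of $R$). Rotate$(r,c)$: let $s_1=ab$ be a segment of $r$ containing $p\in P$, and let $s_2=cd$ be a segment of $r$ such that its endpoint $c$ lies in $ap\subset s_1$ and $ac$ does not contain any endpoints of other segments. The operation shortens $s_1$ to $cb$ and extends $s_2$ beyond $c$ until it reaches another segment or the boundary of $R$. The graph of rectangulations $G(P)$ has as vertices all rectangulations of $P$, and $r_1,r_2$ are adjacent iff a single flip or rotate operation on $r_1$ produces $r_2$. Both operations are reversible, so $G(P)$ is undirected. The diameter is the maximum graph distance between two vertices (a finite bound includes the assertion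 of connectivity). -}

module Defs where

open import Data.Fin.Base using (Fin)
open import Data.Nat.Base as ℕ using (ℕ; zero; suc)
open import Data.Product.Base using (∃-syntax; _×_)
open import Data.Sum.Base using (_⊎_)
open import Level using (Level; _⊔_)
open import Relation.Binary.Bundles using (StrictTotalOrder)
import Relation.Binary.Construct.StrictToNonStrict as NonStrict
open import Relation.Binary.PropositionalEquality.Core using (_≡_; _≢_)
open import Relation.Nullary.Negation.Core using (¬_)

data Axis : Set where
  horizontal vertical : Axis

perp : Axis → Axis
perp horizontal = vertical
perp vertical   = horizontal

data End : Set where
  low high : End

opposite : End → End
opposite low  = high
opposite high = low

-- The plane is K × K for a strict total order K.  Nothing but the order of
-- coordinates occurs in the definitions; the Euclidean plane is the case in
-- which K is the ordered set of real numbers.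
module Plane {c ℓ₁ ℓ₂ : Level} (K : StrictTotalOrder c ℓ₁ ℓ₂) where

  open StrictTotalOrder K using (Carrier; _≈_; _<_)
  open NonStrict _≈_ _<_ using (_≤_)

  record Point : Set c where
    constructor ⟨_,_⟩
    field
      x y : Carrier

  open Point public

  infix 4 _≈ᵖ_

  _≈ᵖ_ : Point → Point → Set ℓ₁
  u ≈ᵖ v = x u ≈ x v × y u ≈ y v

  along across : Axis → Point → Carrier
  along  horizontal = x
  along  vertical   = y
  across horizontal = y
  across vertical   = x

  point : Axis → (along across : Carrier) → Point
  point horizontal s t = ⟨ s , t ⟩
  point vertical   s t = ⟨ t , s ⟩

  record Rectangle : Set (c ⊔ ℓ₂) where
    field
      left right bottom top : Carrier
      left<right            : left < right
      bottom<top            : bottom < top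

  open Rectangle public

  infix 4 _∈ᴿ_ _∈ᴿ°_ _∈∂_

  _∈ᴿ_ : Point → Rectangle → Set (ℓ₁ ⊔ ℓ₂)
  z ∈ᴿ R = (left R ≤ x z × x z ≤ right R) × (bottom R ≤ y z × y z ≤ top R)

  _∈ᴿ°_ : Point → Rectangle → Set ℓ₂
  z ∈ᴿ° R = (left R < x z × x z < right R) × (bottom R < y z × y z < top R)

  _∈∂_ : Point → Rectangle → Set (ℓ₁ ⊔ ℓ₂)
  z ∈∂ R = z ∈ᴿ R ×
           ((x z ≈ left R ⊎ x z ≈ right R) ⊎ (y z ≈ bottom R ⊎ y z ≈ top R))

  -- level is the constant coordinate: y if horizontal, x if vertical.
  record Segment : Set (c ⊔ ℓ₂) where
    field
      axis        : Axis
      level lo hi : Carrier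
      lo<hi       : lo < hi

  open Segment public

  endpoint : Segment → End → Point
  endpoint s low  = point (axis s) (lo s) (level s)
  endpoint s high = point (axis s) (hi s) (level s)

  infix 4 _∈ˢ_ _∈ˢ°_ _≈ˢ_

  _∈ˢ_ : Point → Segment → Set (ℓ₁ ⊔ ℓ₂)
  z ∈ˢ s = across (axis s) z ≈ level s ×
           lo s ≤ along (axis s) z × along (axis s) z ≤ hi s

  -- relative interior
  _∈ˢ°_ : Point → Segment → Set (ℓ₁ ⊔ ℓ₂)
  z ∈ˢ° s = across (axis s) z ≈ level s ×
            lo s < along (axis s) z × along (axis s) z < hi s

  _≈ˢ_ : Segment → Segment → Set ℓ₁
  s ≈ˢ t = axis s ≡ axis t × level s ≈ level t × lo s ≈ lo t × hi s ≈ hi t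

  Between : Carrier → Carrier → Carrier → Set (ℓ₁ ⊔ ℓ₂)
  Between a b t = (a ≤ t × t ≤ b) ⊎ (b ≤ t × t ≤ a)

  -- Bounding box of u and v, used only when u and v share a coordinate, in
  -- which case it is the closed segment uv.
  infix 4 _∈[_,_]
  _∈[_,_] : Point → Point → Point → Set (ℓ₁ ⊔ ℓ₂)
  z ∈[ u , v ] = Between (x u) (x v) (x z) × Between (y u) (y v) (y z)

  Noncorectilinear : ∀ {n} → (Fin n → Point) → Set ℓ₁
  Noncorectilinear P = ∀ i j → i ≢ j → ¬ (x (P i) ≈ x (P j)) × ¬ (y (P i) ≈ y (P j))

  module _ {n : ℕ} (R : Rectangle) (P : Fin n → Point) where

    -- Q is the closure of a face of the subdivision of R by the segments seg:
    -- seg avoids the interior of Q, and seg and ∂R together cover ∂Q.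
    record IsTile (seg : Fin n → Segment) (Q : Rectangle) : Set (c ⊔ ℓ₁ ⊔ ℓ₂) where
      field
        within : ∀ z → z ∈ᴿ Q → z ∈ᴿ R
        empty  : ∀ z → z ∈ᴿ° Q → ∀ i → ¬ z ∈ˢ seg i
        walled : ∀ z → z ∈∂ Q → z ∈∂ R ⊎ (∃[ i ] z ∈ˢ seg i)

    -- Noncrossing segments cannot share a point of P in their relative
    -- interiors, so n segments each containing one of the n points
    -- correspond bijectively to the points; seg i is the segment through P i.
    record Rectangulation : Set (c ⊔ ℓ₁ ⊔ ℓ₂) where
      field
        seg         : Fin n → Segment
        through     : ∀ i → P i ∈ˢ° seg i
        only        : ∀ i j → P j ∈ˢ seg i → j ≡ i
        within      : ∀ i z → z ∈ˢ seg i → z ∈ᴿ R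
        noncrossing : ∀ i j → i ≢ j → ∀ z → z ∈ˢ° seg i → ¬ z ∈ˢ° seg j
        ends        : ∀ i e → endpoint (seg i) e ∈∂ R ⊎
                        (∃[ j ] axis (seg j) ≡ perp (axis (seg i)) ×
                                endpoint (seg i) e ∈ˢ° seg j)
        subdivision : ∀ z → z ∈ᴿ° R → (∀ i → ¬ z ∈ˢ seg i) →
                        ∃[ Q ] z ∈ᴿ° Q × IsTile seg Q

    open Rectangulation public using (seg)

  module _ {n : ℕ} {R : Rectangle} {P : Fin n → Point} where

    infix 4 _≋_

    _≋_ : Rectangulation R P → Rectangulation R P → Set ℓ₁
    r ≋ r′ = ∀ i → seg r i ≈ˢ seg r′ i

    -- The boundary of R or a segment other than the i-th stops an extension
    -- of the i-th segment at z.
    Blocked : Rectangulation R P → Fin n → Point → Set (ℓ₁ ⊔ ℓ₂)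
    Blocked r i z = z ∈∂ R ⊎ (∃[ j ] j ≢ i × z ∈ˢ seg r j)

    record Flip (r : Rectangulation R P) (p : Fin n) (r′ : Rectangulation R P)
                : Set (c ⊔ ℓ₁ ⊔ ℓ₂) where
      field
        free      : ∀ j → j ≢ p → ∀ e → ¬ endpoint (seg r j) e ∈ˢ seg r p
        turned    : axis (seg r′ p) ≡ perp (axis (seg r p))
        reaches   : ∀ e → Blocked r p (endpoint (seg r′ p) e)
        clear     : ∀ z → z ∈ˢ° seg r′ p → ¬ Blocked r p z
        unchanged : ∀ j → j ≢ p → seg r′ j ≈ˢ seg r j

    -- s₁ = ab is the i-th segment, with a its e-end; s₂ = cd is the k-th
    -- segment, with c its f-end.
    record Rotate (r : Rectangulation R P) (i k : Fin n) (e f : End)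
                  (r′ : Rectangulation R P) : Set (c ⊔ ℓ₁ ⊔ ℓ₂) where

      s₁  = seg r i
      s₂  = seg r k
      s₁′ = seg r′ i
      s₂′ = seg r′ k

      ptA = endpoint s₁ e
      ptB = endpoint s₁ (opposite e)
      ptC = endpoint s₂ f
      ptD = endpoint s₂ (opposite f)

      field
        distinct  : k ≢ i
        c∈ap      : ptC ∈[ ptA , P i ]
        c∈s₁      : ptC ∈ˢ s₁
        ac-free   : ∀ j → j ≢ i → j ≢ k → ∀ g → ¬ endpoint (seg r j) g ∈[ ptA , ptC ]

        axis₁     : axis s₁′ ≡ axis s₁
        shortened : endpoint s₁′ e ≈ᵖ ptC
        keeps-b   : endpoint s₁′ (opposite e) ≈ᵖ ptB

        axis₂     : axis s₂′ ≡ axis s₂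
        keeps-d   : endpoint s₂′ (opposite f) ≈ᵖ ptD
        beyond-c  : ptC ∈ˢ° s₂′
        reaches   : Blocked r k (endpoint s₂′ f)
        clear     : ∀ z → z ∈ˢ° s₂′ → ¬ z ∈ˢ s₂ → ¬ Blocked r k z

        unchanged : ∀ j → j ≢ i → j ≢ k → seg r′ j ≈ˢ seg r j

    Adjacent : Rectangulation R P → Rectangulation R P → Set (c ⊔ ℓ₁ ⊔ ℓ₂)
    Adjacent r r′ = (∃[ p ] Flip r p r′) ⊎
                    (∃[ i ] ∃[ k ] ∃[ e ] ∃[ f ] Rotate r i k e f r′)

    -- Vertices of G(P) are rectangulations up to _≋_.
    data Walk : ℕ → Rectangulation R P → Rectangulation R P → Set (c ⊔ ℓ₁ ⊔ ℓ₂) where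
      stop : ∀ {r r′} → r ≋ r′ → Walk zero r r′
      step : ∀ {m r r′ r″} → Adjacent r r′ → Walk m r′ r″ → Walk (suc m) r r″

  DiameterAtMost : ∀ {n} → Rectangle → (Fin n → Point) → ℕ → Set (c ⊔ ℓ₁ ⊔ ℓ₂)
  DiameterAtMost R P d =
    (r r′ : Rectangulation R P) → ∃[ m ] m ℕ.≤ d × Walk m r r′

{-# OPTIONS --safe #-}

-- Every rectangulation is joined to the one with only vertical segments, and
-- both moves are reversible.  To turn a horizontal segment vertical, rotate the
-- segments that end on it past it, one by one from its ends inwards, and then
-- flip it: with t segment ends on it this takes t + 1 moves.  Each of the at
-- most 2n segment ends lies on at most one segment, so among h horizontal
-- segments some has t ≤ 2n / h.  Turning the least touched one each time costs at
-- most the sum of 2n / h + 1 over h ≤ n, which is O(n log n).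

module Submission where

open import Defs
open import Data.Empty using (⊥)
open import Data.Fin.Base using (Fin; zero; suc)
open import Data.Fin.Induction using (spo-wellFounded)
import Data.Fin.Properties as Fin
open import Data.Maybe.Base using (Maybe; just; nothing)
open import Data.Maybe.Properties using (just-injective; ≡-dec)
open import Data.Nat.Base
  using (ℕ; zero; suc; z≤n; s≤s; s≤s⁻¹; _+_; _*_; _≤_; _<_; _^_; ⌊_/2⌋; ⌈_/2⌉)
open import Data.Nat.DivMod using (_/_; /-monoʳ-≤; /-monoˡ-≤; m*n/n≡m; m/n*n≤m)
open import Data.Nat.Logarithm using (⌊log₂_⌋; ⌊log₂⌋-mono-≤; ⌊log₂[2^n]⌋≡n)
import Data.Nat.Properties as ℕ
open import Data.Nat.Tactic.RingSolver using (solve-∀)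
open import Data.Product.Base using (∃-syntax; _×_; _,_; proj₁; proj₂)
open import Data.Sum.Base using (_⊎_; inj₁; inj₂; reduce)
open import Algebra.Properties.Semiring.Sum ℕ.+-*-semiring
  using (sum; ∑-comm; ∑-distrib-+; *-distribʳ-sum)
open import Induction.WellFounded using (Acc; acc)
open import Level using (Level; _⊔_)
open import Relation.Binary.Bundles using (StrictTotalOrder)
open import Relation.Binary.Core using (Rel)
import Relation.Binary.Construct.StrictToNonStrict as NonStrict
open import Relation.Binary.Definitions
  using (Tri; tri<; tri≈; tri>; Total; Transitive; Decidable; DecidableEquality)
open import Relation.Binary.PropositionalEquality
  using (_≡_; _≢_; refl; sym; trans; cong; subst; isEquivalence)
open import Relation.Binary.Structures using (IsStrictPartialOrder)
open import Relation.Nullary.Decidable.Core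
  using (Dec; yes; no; map′; _×-dec_; _⊎-dec_; ¬?)
open import Relation.Nullary.Negation.Core using (¬_; contradiction)
import Relation.Unary as Unary

-- Axes, ends and finite choices

-- The moves are made on finite data. A `Layout` records the axis of each segment and what stops
-- each of its ends; together with `P` and `R` this determines all segments, and `Valid` is what
-- makes it a rectangulation. The demanding part is the field `subdivision`: the face around a point
-- must be a rectangle, which rests on a descent that excludes an endless inward chain of segments.
-- Reversibility is built into the description of a move: `Turn` and `Swap` speak of both layouts
-- and are invariant under exchanging them, so one translation into `Flip` or `Rotate` serves both
-- directions. The least touched segment is chosen afresh after each flip, because moves shift ends
-- onto other segments and so may raise their counts. The bound on the total count holds in every
-- layout, and rotations keep all axes, so each round lowers the number of horizontal segments. The
-- target is the same for every start, because segments of one axis cannot stop each other and hence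
-- all reach the boundary.

data _⟂_ : Axis → Axis → Set where
  h⟂v : horizontal ⟂ vertical
  v⟂h : vertical ⟂ horizontal

-- With one constructor per order, the two axes play equal parts and symmetry holds by matching;
-- `b ≡ perp a` would be lopsided, since `perp (perp a)` does not reduce to `a`.
⟂-sym : ∀ {a b} → a ⟂ b → b ⟂ a
⟂-sym h⟂v = v⟂h
⟂-sym v⟂h = h⟂v

⟂-perp : ∀ a → a ⟂ perp a
⟂-perp horizontal = h⟂v
⟂-perp vertical   = v⟂h

⟂⇒perp : ∀ {a b} → a ⟂ b → b ≡ perp a
⟂⇒perp h⟂v = refl
⟂⇒perp v⟂h = refl

⟂-unique : ∀ {a b d} → a ⟂ b → a ⟂ d → b ≡ d
⟂-unique p q = trans (⟂⇒perp p) (sym (⟂⇒perp q))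

⟂⇒≢ : ∀ {a b} → a ⟂ b → a ≢ b
⟂⇒≢ h⟂v ()
⟂⇒≢ v⟂h ()

⟂-cases : ∀ {a b} → a ⟂ b → ∀ d → d ≡ a ⊎ d ≡ b
⟂-cases h⟂v horizontal = inj₁ refl
⟂-cases h⟂v vertical   = inj₂ refl
⟂-cases v⟂h horizontal = inj₂ refl
⟂-cases v⟂h vertical   = inj₁ refl

End-cases : ∀ e g → g ≡ e ⊎ g ≡ opposite e
End-cases low  low  = inj₁ refl
End-cases low  high = inj₂ refl
End-cases high low  = inj₂ refl
End-cases high high = inj₁ refl

opposite-≢ : ∀ e → opposite e ≢ e
opposite-≢ low  ()
opposite-≢ high ()

_≟ᴬ_ : DecidableEquality Axis
horizontal ≟ᴬ horizontal = yes refl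
horizontal ≟ᴬ vertical   = no λ ()
vertical   ≟ᴬ horizontal = no λ ()
vertical   ≟ᴬ vertical   = yes refl

_≟ᴱ_ : DecidableEquality End
low  ≟ᴱ low  = yes refl
low  ≟ᴱ high = no λ ()
high ≟ᴱ low  = no λ ()
high ≟ᴱ high = yes refl

all-ends? : ∀ {p} {Q : End → Set p} → Unary.Decidable Q → Dec (∀ e → Q e)
all-ends? Q? = map′ (λ { (p , q) low → p ; (p , q) high → q })
                    (λ p → p low , p high) (Q? low ×-dec Q? high)

-- Stated for any total preorder, so that one search finds the nearest obstacle of a ray, the
-- outermost segment ending on another, and the least touched segment. Reflexivity comes from
-- totality through `reduce`.
least : ∀ {n p r} {Q : Fin n → Set p} {_≼_ : Rel (Fin n) r} →
        Total _≼_ → Transitive _≼_ → Unary.Decidable Q →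
        (∃[ k ] Q k × (∀ j → Q j → k ≼ j)) ⊎ (∀ j → ¬ Q j)
least {zero}  total ≼-trans Q? = inj₂ λ ()
least {suc n} {Q = Q} {_≼_} total ≼-trans Q?
  with Q? zero
     | least {Q = λ j → Q (suc j)} {λ i j → suc i ≼ suc j}
             (λ i j → total (suc i) (suc j)) ≼-trans (λ j → Q? (suc j))
... | no ¬q | inj₂ none = inj₂ λ { zero → ¬q ; (suc j) → none j }
... | no ¬q | inj₁ (k , p , k≼) =
  inj₁ (suc k , p , λ { zero q → contradiction q ¬q ; (suc j) → k≼ j })
... | yes q | inj₂ none =
  inj₁ (zero , q , λ { zero _ → reduce (total zero zero) ; (suc j) p → contradiction p (none j) })
... | yes q | inj₁ (k , p , k≼) with total zero (suc k)
...   | inj₁ 0≼k =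
  inj₁ (zero , q , λ { zero _ → reduce (total zero zero) ; (suc j) r → ≼-trans 0≼k (k≼ j r) })
...   | inj₂ k≼0 = inj₁ (suc k , p , λ { zero _ → k≼0 ; (suc j) → k≼ j })

-- Finite sums and harmonic numbers

sum-mono-≤ : ∀ {n} {f g : Fin n → ℕ} → (∀ i → f i ≤ g i) → sum f ≤ sum g
sum-mono-≤ {zero}  p = z≤n
sum-mono-≤ {suc n} p = ℕ.+-mono-≤ (p zero) (sum-mono-≤ (λ i → p (suc i)))

sum-mono-< : ∀ {n} {f g : Fin n → ℕ} → (∀ i → f i ≤ g i) → ∀ k → f k < g k → sum f < sum g
sum-mono-< p zero    q = ℕ.+-mono-<-≤ q (sum-mono-≤ (λ i → p (suc i)))
sum-mono-< p (suc k) q = ℕ.+-mono-≤-< (p zero) (sum-mono-< (λ i → p (suc i)) k q)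

sum-≤-const : ∀ {n} {f : Fin n → ℕ} d → (∀ i → f i ≤ d) → sum f ≤ n * d
sum-≤-const {zero}  d p = z≤n
sum-≤-const {suc n} d p = ℕ.+-mono-≤ (p zero) (sum-≤-const d (λ i → p (suc i)))

indicator : ∀ {p} {A : Set p} → Dec A → ℕ
indicator (yes _) = 1
indicator (no _)  = 0

indicator-≤1 : ∀ {p} {A : Set p} (A? : Dec A) → indicator A? ≤ 1
indicator-≤1 (yes _) = ℕ.≤-refl
indicator-≤1 (no _)  = z≤n

indicator-mono : ∀ {p q} {A : Set p} {B : Set q} (A? : Dec A) (B? : Dec B) → (A → B) →
                 indicator A? ≤ indicator B?
indicator-mono (yes a) (yes _) f = ℕ.≤-refl
indicator-mono (yes a) (no ¬b) f = contradiction (f a) ¬b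
indicator-mono (no _)  B?      f = z≤n

indicator-< : ∀ {p q} {A : Set p} {B : Set q} (A? : Dec A) (B? : Dec B) → ¬ A → B →
              indicator A? < indicator B?
indicator-< (yes a) B?      ¬a b = contradiction a ¬a
indicator-< (no _)  (yes _) ¬a b = ℕ.≤-refl
indicator-< (no _)  (no ¬b) ¬a b = contradiction b ¬b

sum-indicator-≤1 : ∀ {n p} {Q : Fin n → Set p} (Q? : ∀ i → Dec (Q i)) →
                   (∀ i j → Q i → Q j → i ≡ j) → sum (λ i → indicator (Q? i)) ≤ 1
sum-indicator-≤1 {zero}  Q? unique = z≤n
sum-indicator-≤1 {suc n} Q? unique with Q? zero
... | no _  = sum-indicator-≤1 (λ i → Q? (suc i)) (λ i j p q → Fin.suc-injective (unique (suc i) (suc j) p q))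
... | yes q = s≤s (ℕ.≤-trans (sum-≤-const 0 (λ i → none i (Q? (suc i)))) (ℕ.≤-reflexive (ℕ.*-zeroʳ n)))
  where
  none : ∀ i (d : Dec _) → indicator d ≤ 0
  none i (yes r) with () ← unique zero (suc i) q r
  none i (no _)  = z≤n

-- A whole-number stand-in for `N` times the `h`-th harmonic number. Rounding down each term loses
-- nothing, because a natural number `t` with `h * t ≤ N` is at most the floor of the quotient.
harmonic : ℕ → ℕ → ℕ
harmonic N zero    = 0
harmonic N (suc h) = N / suc h + harmonic N h

-- Each of the `d` added terms has a divisor of at least `suc m`.
harmonic-+ : ∀ N m d → harmonic N (m + d) ≤ d * (N / suc m) + harmonic N m
harmonic-+ N m zero    rewrite ℕ.+-identityʳ m = ℕ.≤-refl
harmonic-+ N m (suc d) rewrite ℕ.+-suc m d | ℕ.+-assoc (N / suc m) (d * (N / suc m)) (harmonic N m) =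
  ℕ.+-mono-≤ (/-monoʳ-≤ N (s≤s (ℕ.m≤m+n m d))) (harmonic-+ N m d)

-- Dyadic splitting: the upper half of the terms sums to at most `N`, and the lower half needs one
-- power of two less.
harmonic-≤ : ∀ N k h → h < 2 ^ k → harmonic N h ≤ k * N
harmonic-≤ N zero    zero    p = z≤n
harmonic-≤ N zero    (suc h) (s≤s ())
harmonic-≤ N (suc k) h       p = begin
  harmonic N h                       ≡⟨ cong (harmonic N) (ℕ.⌊n/2⌋+⌈n/2⌉≡n h) ⟨
  harmonic N (m + d)                 ≤⟨ harmonic-+ N m d ⟩
  d * (N / suc m) + harmonic N m     ≤⟨ ℕ.+-mono-≤ first-half (harmonic-≤ N k m m<2^k) ⟩
  N + k * N                          ∎
  where
  open ℕ.≤-Reasoning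
  m d : ℕ
  m = ⌊ h /2⌋
  d = ⌈ h /2⌉
  first-half : d * (N / suc m) ≤ N
  first-half = begin
    -- Rests on `⌈ h /2⌉ ≤ suc ⌊ h /2⌋`: the upper half has at most as many terms as its smallest
    -- divisor.
    d * (N / suc m)      ≤⟨ ℕ.*-monoˡ-≤ (N / suc m) (ℕ.⌊n/2⌋-mono (ℕ.n≤1+n (suc h))) ⟩
    suc m * (N / suc m)  ≡⟨ ℕ.*-comm (suc m) (N / suc m) ⟩
    N / suc m * suc m    ≤⟨ m/n*n≤m N (suc m) ⟩
    N                    ∎
  m<2^k : m < 2 ^ k
  m<2^k = ℕ.≰⇒> λ q → ℕ.<⇒≱ p (begin
    2 * 2 ^ k          ≡⟨ cong (2 ^ k +_) (ℕ.+-identityʳ (2 ^ k)) ⟩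
    2 ^ k + 2 ^ k      ≤⟨ ℕ.+-mono-≤ q (ℕ.≤-trans q (ℕ.⌊n/2⌋≤⌈n/2⌉ h)) ⟩
    m + d              ≡⟨ ℕ.⌊n/2⌋+⌈n/2⌉≡n h ⟩
    h                  ∎)

n<2^[1+⌊log₂n⌋] : ∀ n → n < 2 ^ suc ⌊log₂ n ⌋
n<2^[1+⌊log₂n⌋] n = ℕ.≰⇒> λ p → ℕ.<-irrefl refl
  (subst (_≤ ⌊log₂ n ⌋) (⌊log₂[2^n]⌋≡n (suc ⌊log₂ n ⌋)) (⌊log₂⌋-mono-≤ p))

-- The price of straightening one rectangulation: the trailing `n` pays for the flips, the rest for
-- the rotations.
cost : ℕ → ℕ
cost n = harmonic (n * 2) n + n

-- Origin of the constant: two walks cost at most `4nl + 6n` with `l = ⌊log₂ n⌋`, and `n ≥ 2` gives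
-- `l ≥ 1`, which absorbs the linear term.
cost-≤ : ∀ n → 2 ≤ n → cost n + cost n ≤ 10 * n * ⌊log₂ n ⌋
cost-≤ n 2≤n = begin
  cost n + cost n                                       ≤⟨ ℕ.+-mono-≤ bound bound ⟩
  (suc l * (n * 2) + n) + (suc l * (n * 2) + n)         ≡⟨ expand n l ⟩
  4 * n * l + 6 * n * 1                                 ≤⟨ ℕ.+-monoʳ-≤ (4 * n * l) (ℕ.*-monoʳ-≤ (6 * n) 1≤l) ⟩
  4 * n * l + 6 * n * l                                 ≡⟨ collect n l ⟩
  10 * n * l                                            ∎
  where
  open ℕ.≤-Reasoning
  l : ℕ
  l = ⌊log₂ n ⌋
  1≤l : 1 ≤ l
  1≤l = subst (_≤ l) (⌊log₂[2^n]⌋≡n 1) (⌊log₂⌋-mono-≤ 2≤n)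
  bound : cost n ≤ suc l * (n * 2) + n
  bound = ℕ.+-monoˡ-≤ n (harmonic-≤ (n * 2) (suc l) n (n<2^[1+⌊log₂n⌋] n))
  expand : ∀ n l → (suc l * (n * 2) + n) + (suc l * (n * 2) + n) ≡ 4 * n * l + 6 * n * 1
  expand = solve-∀
  collect : ∀ n l → 4 * n * l + 6 * n * l ≡ 10 * n * l
  collect = solve-∀

-- Geometry, uniformly in the axis and the direction

module Geometry {c ℓ₁ ℓ₂ : Level} (K : StrictTotalOrder c ℓ₁ ℓ₂) where

  open Plane K
  open StrictTotalOrder K using (Carrier; _≈_; module Eq) renaming (_<_ to _<ᴷ_)
  private module K = StrictTotalOrder K
  open NonStrict _≈_ _<ᴷ_ using () renaming (_≤_ to _≤ᴷ_)

  -- u <[ e ] v says that u lies on the e-side of v.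
  data Beyond (u v : Carrier) : End → Set ℓ₂ where
    below : u <ᴷ v → Beyond u v low
    above : v <ᴷ u → Beyond u v high

  infix 4 _<[_]_ _≤[_]_

  -- `Beyond` is an inductive family and not a case distinction on `e`, so that unification recovers
  -- the end and both coordinates from the type.
  _<[_]_ : Carrier → End → Carrier → Set ℓ₂
  u <[ e ] v = Beyond u v e

  -- A negation instead of a sum of cases; trichotomy recovers the cases in `≤-split` when they are
  -- wanted.
  _≤[_]_ : Carrier → End → Carrier → Set ℓ₂
  u ≤[ e ] v = ¬ v <[ e ] u

  <-trans : ∀ {e u v w} → u <[ e ] v → v <[ e ] w → u <[ e ] w
  <-trans (below p) (below q) = below (K.trans p q)
  <-trans (above p) (above q) = above (K.trans q p)

  <-irrefl : ∀ {e u v} → u ≈ v → ¬ u <[ e ] v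
  <-irrefl p (below q) = K.irrefl p q
  <-irrefl p (above q) = K.irrefl (Eq.sym p) q

  <-asym : ∀ {e u v} → u <[ e ] v → ¬ v <[ e ] u
  <-asym p q = <-irrefl Eq.refl (<-trans p q)

  <-respʳ : ∀ {e u v w} → v ≈ w → u <[ e ] v → u <[ e ] w
  <-respʳ p (below q) = below (K.<-respʳ-≈ p q)
  <-respʳ p (above q) = above (K.<-respˡ-≈ p q)

  <-respˡ : ∀ {e u v w} → v ≈ w → v <[ e ] u → w <[ e ] u
  <-respˡ p (below q) = below (K.<-respˡ-≈ p q)
  <-respˡ p (above q) = above (K.<-respʳ-≈ p q)

  <-flip : ∀ {e u v} → u <[ e ] v → v <[ opposite e ] u
  <-flip (below p) = above p
  <-flip (above p) = below p

  <-unflip : ∀ {e u v} → u <[ opposite e ] v → v <[ e ] u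
  <-unflip {low}  (above p) = below p
  <-unflip {high} (below p) = above p

  <-compare : ∀ e u v → Tri (u <[ e ] v) (u ≈ v) (v <[ e ] u)
  <-compare e u v with K.compare u v | e
  ... | tri< p _ _ | low  = tri< (below p) (λ q → K.irrefl q p) (<-asym (below p))
  ... | tri< p _ _ | high = tri> (<-asym (above p)) (λ q → K.irrefl q p) (above p)
  ... | tri≈ _ p _ | _    = tri≈ (<-irrefl p) p (<-irrefl (Eq.sym p))
  ... | tri> _ _ p | low  = tri> (<-asym (below p)) (λ q → K.irrefl (Eq.sym q) p) (below p)
  ... | tri> _ _ p | high = tri< (above p) (λ q → K.irrefl (Eq.sym q) p) (<-asym (above p))

  ≤-<-trans : ∀ {e u v w} → u ≤[ e ] v → v <[ e ] w → u <[ e ] w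
  ≤-<-trans {e} {u} {v} p q with <-compare e u v
  ... | tri< r _ _ = <-trans r q
  ... | tri≈ _ r _ = <-respˡ (Eq.sym r) q
  ... | tri> _ _ r = contradiction r p

  <-≤-trans : ∀ {e u v w} → u <[ e ] v → v ≤[ e ] w → u <[ e ] w
  <-≤-trans {e} {u} {v} {w} p q with <-compare e v w
  ... | tri< r _ _ = <-trans p r
  ... | tri≈ _ r _ = <-respʳ r p
  ... | tri> _ _ r = contradiction r q

  ≤-trans : ∀ {e u v w} → u ≤[ e ] v → v ≤[ e ] w → u ≤[ e ] w
  ≤-trans p q r = q (<-≤-trans r p)

  <⇒≤ : ∀ {e u v} → u <[ e ] v → u ≤[ e ] v
  <⇒≤ = <-asym

  ≈⇒≤ : ∀ {e u v} → u ≈ v → u ≤[ e ] v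
  ≈⇒≤ p = <-irrefl (Eq.sym p)

  ≤-flip : ∀ {e u v} → u ≤[ e ] v → v ≤[ opposite e ] u
  ≤-flip p q = p (<-unflip q)

  ≤-unflip : ∀ {e u v} → u ≤[ opposite e ] v → v ≤[ e ] u
  ≤-unflip p q = p (<-flip q)

  ≤-antisym : ∀ {e u v} → u ≤[ e ] v → v ≤[ e ] u → u ≈ v
  ≤-antisym {e} {u} {v} p q with <-compare e u v
  ... | tri< r _ _ = contradiction r q
  ... | tri≈ _ r _ = r
  ... | tri> _ _ r = contradiction r p

  ≤-split : ∀ {e u v} → u ≤[ e ] v → u <[ e ] v ⊎ u ≈ v
  ≤-split {e} {u} {v} p with <-compare e u v
  ... | tri< r _ _ = inj₁ r
  ... | tri≈ _ r _ = inj₂ r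
  ... | tri> _ _ r = contradiction r p

  ≤-total : ∀ e u v → u ≤[ e ] v ⊎ v ≤[ e ] u
  ≤-total e u v with <-compare e u v
  ... | tri< r _ _ = inj₁ (<⇒≤ r)
  ... | tri≈ _ r _ = inj₁ (≈⇒≤ r)
  ... | tri> _ _ r = inj₂ (<⇒≤ r)

  from-≤ : ∀ {u v} → u ≤ᴷ v → u ≤[ low ] v
  from-≤ (inj₁ p) = <⇒≤ (below p)
  from-≤ (inj₂ p) = ≈⇒≤ p

  to-≤ : ∀ {u v} → u ≤[ low ] v → u ≤ᴷ v
  to-≤ p with ≤-split p
  ... | inj₁ (below q) = inj₁ q
  ... | inj₂ q         = inj₂ q

  from-< : ∀ {u v} → u <[ low ] v → u <ᴷ v
  from-< (below p) = p

  end : Segment → End → Carrier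
  end s low  = lo s
  end s high = hi s

  across≡along : ∀ {a b} → a ⟂ b → ∀ z → across a z ≡ along b z
  across≡along h⟂v z = refl
  across≡along v⟂h z = refl

  along-point : ∀ {a} s t → along a (point a s t) ≡ s
  along-point {horizontal} s t = refl
  along-point {vertical}   s t = refl

  along-point-⟂ : ∀ {a b} → a ⟂ b → ∀ s t → along b (point a s t) ≡ t
  along-point-⟂ h⟂v s t = refl
  along-point-⟂ v⟂h s t = refl

  point-swap : ∀ {a b} → a ⟂ b → ∀ s t → point a s t ≡ point b t s
  point-swap h⟂v s t = refl
  point-swap v⟂h s t = refl

  along-endpoint : ∀ {a} s e → axis s ≡ a → along a (endpoint s e) ≡ end s e
  along-endpoint s low  refl = along-point {axis s} _ _
  along-endpoint s high refl = along-point {axis s} _ _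

  along-endpoint-⟂ : ∀ {a b} s e → a ⟂ b → axis s ≡ a → along b (endpoint s e) ≡ level s
  along-endpoint-⟂ s low  a⟂b refl = along-point-⟂ a⟂b _ _
  along-endpoint-⟂ s high a⟂b refl = along-point-⟂ a⟂b _ _

  -- Both ends take the form `end s g ≤[ g ] along a z`, so later arguments treat the low and the
  -- high end at once, for an axis known only through an equation.
  ∈ˢ⇒ : ∀ {a b z} s → a ⟂ b → axis s ≡ a → z ∈ˢ s →
        along b z ≈ level s × (∀ g → end s g ≤[ g ] along a z)
  ∈ˢ⇒ {z = z} s a⟂b refl (p , q , r) rewrite across≡along a⟂b z =
    p , λ { low → from-≤ q ; high → ≤-flip (from-≤ r) }

  ⇒∈ˢ : ∀ {a b z} s → a ⟂ b → axis s ≡ a →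
        along b z ≈ level s → (∀ g → end s g ≤[ g ] along a z) → z ∈ˢ s
  ⇒∈ˢ {z = z} s a⟂b refl p q rewrite across≡along a⟂b z =
    p , to-≤ (q low) , to-≤ (≤-unflip (q high))

  ∈ˢ°⇒ : ∀ {a b z} s → a ⟂ b → axis s ≡ a → z ∈ˢ° s →
         along b z ≈ level s × (∀ g → end s g <[ g ] along a z)
  ∈ˢ°⇒ {z = z} s a⟂b refl (p , q , r) rewrite across≡along a⟂b z =
    p , λ { low → below q ; high → above r }

  ⇒∈ˢ° : ∀ {a b z} s → a ⟂ b → axis s ≡ a →
         along b z ≈ level s → (∀ g → end s g <[ g ] along a z) → z ∈ˢ° s
  ⇒∈ˢ° {z = z} s a⟂b refl p q rewrite across≡along a⟂b z =
    p , from-< (q low) , from-< (<-unflip (q high))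

  bound : Rectangle → Axis → End → Carrier
  bound Q horizontal low  = left Q
  bound Q horizontal high = right Q
  bound Q vertical   low  = bottom Q
  bound Q vertical   high = top Q

  ∈ᴿ⇒ : ∀ {Q z} → z ∈ᴿ Q → ∀ a e → bound Q a e ≤[ e ] along a z
  ∈ᴿ⇒ ((p , q) , (r , s)) horizontal low  = from-≤ p
  ∈ᴿ⇒ ((p , q) , (r , s)) horizontal high = ≤-flip (from-≤ q)
  ∈ᴿ⇒ ((p , q) , (r , s)) vertical   low  = from-≤ r
  ∈ᴿ⇒ ((p , q) , (r , s)) vertical   high = ≤-flip (from-≤ s)

  ⇒∈ᴿ : ∀ {Q z} → (∀ a e → bound Q a e ≤[ e ] along a z) → z ∈ᴿ Q
  ⇒∈ᴿ p = (to-≤ (p horizontal low) , to-≤ (≤-unflip (p horizontal high))) ,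
          (to-≤ (p vertical low) , to-≤ (≤-unflip (p vertical high)))

  ∈ᴿ°⇒ : ∀ {Q z} → z ∈ᴿ° Q → ∀ a e → bound Q a e <[ e ] along a z
  ∈ᴿ°⇒ ((p , q) , (r , s)) horizontal low  = below p
  ∈ᴿ°⇒ ((p , q) , (r , s)) horizontal high = above q
  ∈ᴿ°⇒ ((p , q) , (r , s)) vertical   low  = below r
  ∈ᴿ°⇒ ((p , q) , (r , s)) vertical   high = above s

  ⇒∈ᴿ° : ∀ {Q z} → (∀ a e → bound Q a e <[ e ] along a z) → z ∈ᴿ° Q
  ⇒∈ᴿ° p = (from-< (p horizontal low) , from-< (<-unflip (p horizontal high))) ,
           (from-< (p vertical low) , from-< (<-unflip (p vertical high)))

  ∈∂⇒ : ∀ {Q z} → z ∈∂ Q → ∃[ a ] ∃[ e ] along a z ≈ bound Q a e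
  ∈∂⇒ (_ , inj₁ (inj₁ p)) = horizontal , low , p
  ∈∂⇒ (_ , inj₁ (inj₂ p)) = horizontal , high , p
  ∈∂⇒ (_ , inj₂ (inj₁ p)) = vertical , low , p
  ∈∂⇒ (_ , inj₂ (inj₂ p)) = vertical , high , p

  ⇒∈∂ : ∀ {Q z} → z ∈ᴿ Q → ∀ a e → along a z ≈ bound Q a e → z ∈∂ Q
  ⇒∈∂ i horizontal low  p = i , inj₁ (inj₁ p)
  ⇒∈∂ i horizontal high p = i , inj₁ (inj₂ p)
  ⇒∈∂ i vertical   low  p = i , inj₂ (inj₁ p)
  ⇒∈∂ i vertical   high p = i , inj₂ (inj₂ p)

  ⇒≈ᵖ : ∀ {a b u v} → a ⟂ b → along a u ≈ along a v → along b u ≈ along b v → u ≈ᵖ v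
  ⇒≈ᵖ h⟂v p q = p , q
  ⇒≈ᵖ v⟂h p q = q , p

  ≈ᵖ⇒ : ∀ {u v} → u ≈ᵖ v → ∀ a → along a u ≈ along a v
  ≈ᵖ⇒ p horizontal = proj₁ p
  ≈ᵖ⇒ p vertical   = proj₂ p

  ⇒Between : ∀ e {u v t} → u ≤[ e ] t → t ≤[ e ] v → Between u v t
  ⇒Between low  p q = inj₁ (to-≤ p , to-≤ q)
  ⇒Between high p q = inj₂ (to-≤ (≤-unflip q) , to-≤ (≤-unflip p))

  -- `Between` leaves the order of its limits open. The hypothesis `u ≤[ e ] v` selects one order;
  -- under the other, all three values coincide.
  Between⇒ : ∀ e {u v t} → u ≤[ e ] v → Between u v t → u ≤[ e ] t × t ≤[ e ] v
  Between⇒ low  p (inj₁ (q , r)) = from-≤ q , from-≤ r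
  Between⇒ low  p (inj₂ (q , r)) =
    ≤-trans p (from-≤ q) , ≤-trans (from-≤ r) p
  Between⇒ high p (inj₁ (q , r)) =
    ≤-trans p (≤-flip (from-≤ r)) , ≤-trans (≤-flip (from-≤ q)) p
  Between⇒ high p (inj₂ (q , r)) = ≤-flip (from-≤ r) , ≤-flip (from-≤ q)

  ⇒box : ∀ {a b u v z} → a ⟂ b → Between (along a u) (along a v) (along a z) →
         Between (along b u) (along b v) (along b z) → z ∈[ u , v ]
  ⇒box h⟂v p q = p , q
  ⇒box v⟂h p q = q , p

  box⇒ : ∀ {u v z} → z ∈[ u , v ] → ∀ a → Between (along a u) (along a v) (along a z)
  box⇒ p horizontal = proj₁ p
  box⇒ p vertical   = proj₂ p

  ≈ˢ-sym : ∀ s t → s ≈ˢ t → t ≈ˢ s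
  ≈ˢ-sym s t (p , q , r , u) = sym p , Eq.sym q , Eq.sym r , Eq.sym u

  ≈ˢ-trans : ∀ s t w → s ≈ˢ t → t ≈ˢ w → s ≈ˢ w
  ≈ˢ-trans s t w (p , q , r , u) (p′ , q′ , r′ , u′) =
    trans p p′ , Eq.trans q q′ , Eq.trans r r′ , Eq.trans u u′

  ≈ˢ⇒end : ∀ s t → s ≈ˢ t → ∀ g → end s g ≈ end t g
  ≈ˢ⇒end s t (_ , _ , p , _) low  = p
  ≈ˢ⇒end s t (_ , _ , _ , p) high = p

  endpoint-cong : ∀ s t → s ≈ˢ t → ∀ e → endpoint s e ≈ᵖ endpoint t e
  endpoint-cong s t p@(q , r , _) e = ⇒≈ᵖ (⟂-perp (axis t))
    (Eq.trans (Eq.reflexive (along-endpoint s e q))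
      (Eq.trans (≈ˢ⇒end s t p e) (Eq.reflexive (sym (along-endpoint t e refl)))))
    (Eq.trans (Eq.reflexive (along-endpoint-⟂ s e (⟂-perp _) q))
      (Eq.trans r (Eq.reflexive (sym (along-endpoint-⟂ t e (⟂-perp _) refl)))))

  ∈ˢ-resp : ∀ s t {z w} → s ≈ˢ t → z ≈ᵖ w → z ∈ˢ s → w ∈ˢ t
  ∈ˢ-resp s t {z} {w} p@(q , r , _) z≈w z∈ with ∈ˢ⇒ s (⟂-perp (axis t)) q z∈
  ... | x , y = ⇒∈ˢ t (⟂-perp _) refl (Eq.trans (Eq.sym (≈ᵖ⇒ {z} {w} z≈w (perp (axis t)))) (Eq.trans x r))
    (λ g → ≤-trans (≈⇒≤ (Eq.sym (≈ˢ⇒end s t p g))) (≤-trans (y g) (≈⇒≤ (≈ᵖ⇒ {z} {w} z≈w (axis t)))))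

  ∈ˢ°-respᵖ : ∀ s {z w} → z ≈ᵖ w → z ∈ˢ° s → w ∈ˢ° s
  ∈ˢ°-respᵖ s {z} {w} z≈w z∈ with ∈ˢ°⇒ s (⟂-perp _) refl z∈
  ... | x , y = ⇒∈ˢ° s (⟂-perp _) refl (Eq.trans (Eq.sym (≈ᵖ⇒ {z} {w} z≈w (perp (axis s)))) x)
    (λ g → <-respʳ (≈ᵖ⇒ {z} {w} z≈w (axis s)) (y g))

  ≈ᵖ-refl : ∀ {u} → u ≈ᵖ u
  ≈ᵖ-refl = Eq.refl , Eq.refl

  ≈ᵖ-trans : ∀ {u v w} → u ≈ᵖ v → v ≈ᵖ w → u ≈ᵖ w
  ≈ᵖ-trans (p , q) (p′ , q′) = Eq.trans p p′ , Eq.trans q q′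

  ≤-resp : ∀ {u v u′ v′} → u ≈ u′ → v ≈ v′ → u ≤ᴷ v → u′ ≤ᴷ v′
  ≤-resp p q r = to-≤ (≤-trans (≈⇒≤ (Eq.sym p)) (≤-trans (from-≤ r) (≈⇒≤ q)))

  Between-resp : ∀ {u v t u′ v′ t′} → u ≈ u′ → v ≈ v′ → t ≈ t′ → Between u v t → Between u′ v′ t′
  Between-resp p q r (inj₁ (x , y)) = inj₁ (≤-resp p r x , ≤-resp r q y)
  Between-resp p q r (inj₂ (x , y)) = inj₂ (≤-resp q r x , ≤-resp r p y)

  box-resp : ∀ {u v z u′ v′ z′} → u ≈ᵖ u′ → v ≈ᵖ v′ → z ≈ᵖ z′ → z ∈[ u , v ] → z′ ∈[ u′ , v′ ]
  box-resp (p , p′) (q , q′) (r , r′) (x , y) = Between-resp p q r x , Between-resp p′ q′ r′ y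

  -- Invariance of moves and walks under `_≋_`

  module _ {n : ℕ} {R : Rectangle} {P : Fin n → Point} where

    ≋-refl : (r : Rectangulation R P) → r ≋ r
    ≋-refl r i = refl , Eq.refl , Eq.refl , Eq.refl

    ≋-sym : (r s : Rectangulation R P) → r ≋ s → s ≋ r
    ≋-sym r s p i = ≈ˢ-sym (seg r i) (seg s i) (p i)

    ≋-trans : (r s t : Rectangulation R P) → r ≋ s → s ≋ t → r ≋ t
    ≋-trans r s t p q i = ≈ˢ-trans (seg r i) (seg s i) (seg t i) (p i) (q i)

    module _ (r s : Rectangulation R P) (r≋s : r ≋ s) where

      private
        s≋r : s ≋ r
        s≋r = ≋-sym r s r≋s

        s⇒r : ∀ j {z w} → z ≈ᵖ w → z ∈ˢ seg s j → w ∈ˢ seg r j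
        s⇒r j = ∈ˢ-resp (seg s j) (seg r j) (s≋r j)

        r⇒s : ∀ j {z w} → z ≈ᵖ w → z ∈ˢ seg r j → w ∈ˢ seg s j
        r⇒s j = ∈ˢ-resp (seg r j) (seg s j) (r≋s j)

        end≈ : ∀ j g → endpoint (seg s j) g ≈ᵖ endpoint (seg r j) g
        end≈ j g = endpoint-cong (seg s j) (seg r j) (s≋r j) g

        end≈′ : ∀ j g → endpoint (seg r j) g ≈ᵖ endpoint (seg s j) g
        end≈′ j g = endpoint-cong (seg r j) (seg s j) (r≋s j) g

        blocked⇒ : ∀ {i z} → Blocked r i z → Blocked s i z
        blocked⇒ (inj₁ q)           = inj₁ q
        blocked⇒ (inj₂ (j , q , x)) = inj₂ (j , q , r⇒s j ≈ᵖ-refl x)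

        ⇒blocked : ∀ {i z} → Blocked s i z → Blocked r i z
        ⇒blocked (inj₁ q)           = inj₁ q
        ⇒blocked (inj₂ (j , q , x)) = inj₂ (j , q , s⇒r j ≈ᵖ-refl x)

      Flip-respˡ : ∀ {t p} → Flip s p t → Flip r p t
      Flip-respˡ {t} {p} m = record
        { free = λ j q e x → M.free j q e (r⇒s p (end≈′ j e) x)
        ; turned = trans M.turned (cong perp (sym (proj₁ (r≋s p))))
        ; reaches = λ e → ⇒blocked (M.reaches e)
        ; clear = λ z x y → M.clear z x (blocked⇒ y)
        ; unchanged = λ j q → ≈ˢ-trans (seg t j) (seg s j) (seg r j) (M.unchanged j q) (s≋r j) }
        where module M = Flip m

      Rotate-respˡ : ∀ {t i k e f} → Rotate s i k e f t → Rotate r i k e f t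
      Rotate-respˡ {t} {i} {k} {e} {f} m = record
        { distinct = M.distinct
        ; c∈ap = box-resp (end≈ i e) ≈ᵖ-refl (end≈ k f) M.c∈ap
        ; c∈s₁ = s⇒r i (end≈ k f) M.c∈s₁
        ; ac-free = λ j p q g x →
            M.ac-free j p q g (box-resp (end≈′ i e) (end≈′ k f) (end≈′ j g) x)
        ; axis₁ = trans M.axis₁ (sym (proj₁ (r≋s i)))
        ; shortened = ≈ᵖ-trans M.shortened (end≈ k f)
        ; keeps-b = ≈ᵖ-trans M.keeps-b (end≈ i (opposite e))
        ; axis₂ = trans M.axis₂ (sym (proj₁ (r≋s k)))
        ; keeps-d = ≈ᵖ-trans M.keeps-d (end≈ k (opposite f))
        ; beyond-c = ∈ˢ°-respᵖ (seg t k) (end≈ k f) M.beyond-c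
        ; reaches = ⇒blocked M.reaches
        ; clear = λ z x y w → M.clear z x (λ q → y (s⇒r k ≈ᵖ-refl q)) (blocked⇒ w)
        ; unchanged = λ j p q →
            ≈ˢ-trans (seg t j) (seg s j) (seg r j) (M.unchanged j p q) (s≋r j) }
        where module M = Rotate m

      -- `stop` tolerates `_≋_` at the end of a walk, but `step` fixes its source; replacing the
      -- start therefore means transporting the first move.
      Walk-respˡ : ∀ {m t} → Walk m s t → Walk m r t
      Walk-respˡ {t = t} (stop q) = stop (≋-trans r s t r≋s q)
      Walk-respˡ (step (inj₁ (i , q)) w) = step (inj₁ (i , Flip-respˡ q)) w
      Walk-respˡ (step (inj₂ (i , k , e , f , q)) w) =
        step (inj₂ (i , k , e , f , Rotate-respˡ q)) w

    Walk-++ : ∀ {m m′} {r s t : Rectangulation R P} → Walk m r s → Walk m′ s t → Walk (m + m′) r t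
    Walk-++ {r = r} {s} (stop p)   w′ = Walk-respˡ r s p w′
    Walk-++             (step q w) w′ = step q (Walk-++ w w′)

-- Layouts: the combinatorial data of a rectangulation

module Rectangulations {c ℓ₁ ℓ₂ : Level} (K : StrictTotalOrder c ℓ₁ ℓ₂) {n : ℕ}
  (R : Plane.Rectangle K) (P : Fin n → Plane.Point K)
  (P-apart : Plane.Noncorectilinear K P) (P∈R : ∀ i → Plane._∈ᴿ°_ K (P i) R) where

  open Plane K
  open StrictTotalOrder K using (Carrier; _≈_; module Eq)
  open Geometry K

  co : Axis → Fin n → Carrier
  co a i = along a (P i)

  co-injective : ∀ a {i j} → co a i ≈ co a j → i ≡ j
  co-injective a {i} {j} p with i Fin.≟ j | a
  ... | yes q | _          = q
  ... | no q  | horizontal = contradiction p (proj₁ (P-apart i j q))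
  ... | no q  | vertical   = contradiction p (proj₂ (P-apart i j q))

  bound<co : ∀ a e i → bound R a e <[ e ] co a i
  bound<co a e i = ∈ᴿ°⇒ (P∈R i) a e

  -- Where a segment of axis a stops in direction e: at the perpendicular segment
  -- through P j, or at the boundary.
  pos : Axis → End → Maybe (Fin n) → Carrier
  pos a e nothing  = bound R a e
  pos a e (just j) = co a j

  bound≤pos : ∀ a e m → bound R a e ≤[ e ] pos a e m
  bound≤pos a e nothing  = ≈⇒≤ Eq.refl
  bound≤pos a e (just j) = <⇒≤ (bound<co a e j)

  -- Interiority excludes the boundary, and noncorectilinearity makes the point unique. This turns
  -- coincidences of coordinates into equations between indices.
  pos≈co : ∀ {a e j} m → pos a e m ≈ co a j → m ≡ just j
  pos≈co {a} {e} nothing  p = contradiction (bound<co a e _) (<-irrefl p)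
  pos≈co {a}     (just k) p = cong just (co-injective a p)

  record Layout : Set where
    field
      ax   : Fin n → Axis
      halt : Fin n → End → Maybe (Fin n)

  open Layout public

  -- The axis is an argument and not `ax L i`, so that statements can speak of a variable axis and
  -- tie it to the layout by an equation.
  ext : Layout → Axis → Fin n → End → Carrier
  ext L a i e = pos a e (halt L i e)

  Reaches Crosses : Layout → Axis → Fin n → Carrier → Set ℓ₂
  Reaches L a i t = ∀ e → ext L a i e ≤[ e ] t
  Crosses L a i t = ∀ e → ext L a i e <[ e ] t

  -- `lands` asks for `Crosses` and not for `Reaches`: an end lies in the relative interior of the
  -- segment that stops it, so two ends never meet in a corner. Parallel segments are kept apart by
  -- their distinct levels.
  record Valid (L : Layout) : Set ℓ₂ where
    field
      through : ∀ {a} i → ax L i ≡ a → Crosses L a i (co a i)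
      lands   : ∀ {a b e} i j → a ⟂ b → ax L i ≡ a → halt L i e ≡ just j →
                ax L j ≡ b × Crosses L b j (co b i)
      nocross : ∀ {a b} i j → a ⟂ b → ax L i ≡ a → ax L j ≡ b →
                Crosses L a i (co a j) → ¬ Crosses L b j (co b i)

  open Valid public

  -- The ray starts where `a` has coordinate `s` and `b` has coordinate `t`, and runs in direction
  -- `e`. Closed segments stop it, so one whose end merely touches the ray counts; the boundary is
  -- the default.
  record Ray (L : Layout) (a b : Axis) (e : End) (s t : Carrier) : Set ℓ₂ where
    field
      hit    : Maybe (Fin n)
      beyond : pos a e hit <[ e ] s
      hits   : ∀ j → hit ≡ just j → ax L j ≡ b × Reaches L b j t
      first  : ∀ j → ax L j ≡ b → Reaches L b j t → co a j <[ e ] s →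
               co a j ≤[ e ] pos a e hit

  <[]? : ∀ e → Decidable (_<[ e ]_)
  <[]? e u v with <-compare e u v
  ... | tri< p _ _ = yes p
  ... | tri≈ p _ _ = no p
  ... | tri> p _ _ = no p

  ray : ∀ L a b e {s} t → bound R a e <[ e ] s → Ray L a b e s t
  ray L a b e {s} t p
    with least {Q = λ j → (ax L j ≡ b × Reaches L b j t) × co a j <[ e ] s}
               -- The order is reversed, so that a least index is one nearest to `s`.
               {λ i j → co a j ≤[ e ] co a i}
               (λ i j → ≤-total e (co a j) (co a i))
               (λ q r → ≤-trans r q)
               (λ j → ((ax L j ≟ᴬ b) ×-dec all-ends? (λ g → ¬? (<[]? g t (ext L b j g))))
                      ×-dec <[]? e (co a j) s)
  ... | inj₁ (k , (q , r) , max) = record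
    { hit = just k ; beyond = r ; hits = λ { _ refl → q }
    ; first = λ j x y z → max j ((x , y) , z) }
  ... | inj₂ none = record
    { hit = nothing ; beyond = p ; hits = λ _ ()
    ; first = λ j x y z → contradiction ((x , y) , z) (none j) }

  module _ {L : Layout} (v : Valid L) where

    segment : Fin n → Segment
    segment i = record
      { axis = ax L i ; level = co (perp (ax L i)) i
      ; lo = ext L (ax L i) i low ; hi = ext L (ax L i) i high
      ; lo<hi = from-< (<-trans (through v i refl low) (<-unflip (through v i refl high))) }

    level-segment : ∀ {a b} i → a ⟂ b → ax L i ≡ a → level (segment i) ≡ co b i
    level-segment i a⟂b refl rewrite ⟂⇒perp a⟂b = refl

    end-segment : ∀ {a} i e → ax L i ≡ a → end (segment i) e ≡ ext L a i e
    end-segment i low  refl = refl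
    end-segment i high refl = refl

    along-endpoint-segment : ∀ {a} i e → ax L i ≡ a →
                             along a (endpoint (segment i) e) ≡ ext L a i e
    along-endpoint-segment i e p = trans (along-endpoint (segment i) e p) (end-segment i e p)

    along-endpoint-segment-⟂ : ∀ {a b} i e → a ⟂ b → ax L i ≡ a →
                               along b (endpoint (segment i) e) ≡ co b i
    along-endpoint-segment-⟂ i e a⟂b p =
      trans (along-endpoint-⟂ (segment i) e a⟂b p) (level-segment i a⟂b p)

    ∈segment⇒ : ∀ {a b z} i → a ⟂ b → ax L i ≡ a → z ∈ˢ segment i →
                along b z ≈ co b i × Reaches L a i (along a z)
    ∈segment⇒ i a⟂b p q with ∈ˢ⇒ (segment i) a⟂b p q
    ... | r , s = Eq.trans r (Eq.reflexive (level-segment i a⟂b p)) ,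
                  λ e → ≤-trans (≈⇒≤ (Eq.reflexive (sym (end-segment i e p)))) (s e)

    ⇒∈segment : ∀ {a b z} i → a ⟂ b → ax L i ≡ a →
                along b z ≈ co b i → Reaches L a i (along a z) → z ∈ˢ segment i
    ⇒∈segment i a⟂b p r s = ⇒∈ˢ (segment i) a⟂b p
      (Eq.trans r (Eq.reflexive (sym (level-segment i a⟂b p))))
      (λ e → ≤-trans (≈⇒≤ (Eq.reflexive (end-segment i e p))) (s e))

    ∈segment°⇒ : ∀ {a b z} i → a ⟂ b → ax L i ≡ a → z ∈ˢ° segment i →
                 along b z ≈ co b i × Crosses L a i (along a z)
    ∈segment°⇒ i a⟂b p q with ∈ˢ°⇒ (segment i) a⟂b p q
    ... | r , s = Eq.trans r (Eq.reflexive (level-segment i a⟂b p)) ,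
                  λ e → <-respˡ (Eq.reflexive (end-segment i e p)) (s e)

    ⇒∈segment° : ∀ {a b z} i → a ⟂ b → ax L i ≡ a →
                 along b z ≈ co b i → Crosses L a i (along a z) → z ∈ˢ° segment i
    ⇒∈segment° i a⟂b p r s = ⇒∈ˢ° (segment i) a⟂b p
      (Eq.trans r (Eq.reflexive (sym (level-segment i a⟂b p))))
      (λ e → <-respˡ (Eq.reflexive (sym (end-segment i e p))) (s e))

    ext<opposite : ∀ {a} i → ax L i ≡ a → ∀ e → ext L a i e <[ e ] ext L a i (opposite e)
    ext<opposite i p e = <-trans (through v i p e) (<-unflip (through v i p (opposite e)))

    reaches-end : ∀ {a} i e → ax L i ≡ a → Reaches L a i (ext L a i e)
    reaches-end i e p g with End-cases g e
    ... | inj₁ refl = ≈⇒≤ Eq.refl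
    ... | inj₂ refl = <⇒≤ (ext<opposite i p g)

    endpoint∈segment : ∀ i e → endpoint (segment i) e ∈ˢ segment i
    endpoint∈segment i e = ⇒∈segment i (⟂-perp _) refl
      (Eq.reflexive (along-endpoint-segment-⟂ i e (⟂-perp _) refl))
      λ g → ≤-trans (reaches-end i e refl g)
                    (≈⇒≤ (Eq.reflexive (sym (along-endpoint-segment i e refl))))

    segment-within : ∀ i z → z ∈ˢ segment i → z ∈ᴿ R
    segment-within i z p = ⇒∈ᴿ (λ a e → helper a e (⟂-cases (⟂-perp (ax L i)) a))
      where
      q = ∈segment⇒ i (⟂-perp _) refl p
      helper : ∀ a e → a ≡ ax L i ⊎ a ≡ perp (ax L i) → bound R a e ≤[ e ] along a z
      helper a e (inj₁ refl) = ≤-trans (bound≤pos a e (halt L i e)) (proj₂ q e)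
      helper a e (inj₂ refl) = <⇒≤ (<-respʳ (Eq.sym (proj₁ q)) (bound<co a e i))

    -- The faces of a valid layout are rectangles

    module Cell (z : Point) (z∈R : z ∈ᴿ° R) (z∉ : ∀ i → ¬ z ∈ˢ segment i) where

      cellRay : ∀ a e → Ray L a (perp a) e (along a z) (along (perp a) z)
      cellRay a e = ray L a (perp a) e (along (perp a) z) (∈ᴿ°⇒ z∈R a e)

      wall : Axis → End → Carrier
      wall a e = pos a e (Ray.hit (cellRay a e))

      wall< : ∀ a e → wall a e <[ e ] along a z
      wall< a e = Ray.beyond (cellRay a e)

      wall-first : ∀ {a b} e j → a ⟂ b → ax L j ≡ b → Reaches L b j (along b z) →
                   co a j ≤[ e ] along a z → co a j ≤[ e ] wall a e
      wall-first {a} e j a⟂b p q r with ≤-split r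
      ... | inj₂ s = contradiction (⇒∈segment j (⟂-sym a⟂b) p (Eq.sym s) q) (z∉ j)
      ... | inj₁ s rewrite ⟂⇒perp a⟂b = Ray.first (cellRay a e) j p q s

      -- The line of j meets the cell on the e-side of z, and j itself enters the
      -- cell from its f-side without reaching as far as z.
      record Enters (a b : Axis) (e f : End) (j : Fin n) : Set ℓ₂ where
        field
          axis-b    : ax L j ≡ b
          past-wall : wall a e <[ e ] co a j
          before-z  : co a j ≤[ e ] along a z
          tip-past  : wall b f <[ f ] ext L b j (opposite f)
          tip-side  : ext L b j (opposite f) <[ f ] along b z

      -- The segment on which the tip of j ends enters the cell too, with a tip
      -- closer to z than j.  Two such steps return to the axis of j, so finiteness
      -- makes the cell empty.
      enters-step : ∀ {a b e f} j → a ⟂ b → Enters a b e f j →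
                    ∃[ m ] Enters b a f e m × co b m ≡ ext L b j (opposite f) ×
                           co a j <[ e ] ext L a m (opposite e)
      enters-step {a} {b} {e} {f} j a⟂b ent with halt L j (opposite f) in eq
      ... | nothing = contradiction
              (<-unflip (∈ᴿ°⇒ z∈R b (opposite f)))
              (<-asym (subst (λ m → pos b (opposite f) m <[ f ] along b z) eq tip-side))
        where open Enters ent
      ... | just m = m , record
              { axis-b = proj₁ on-m ; past-wall = m-past ; before-z = <⇒≤ m-before
              ; tip-past = <-trans past-wall closer ; tip-side = side }
              , refl , closer
        where
        open Enters ent
        on-m = lands v j m (⟂-sym a⟂b) axis-b eq
        m-past : wall b f <[ f ] co b m
        m-past = subst (λ m → wall b f <[ f ] pos b (opposite f) m) eq tip-past
        m-before : co b m <[ f ] along b z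
        m-before = subst (λ m → pos b (opposite f) m <[ f ] along b z) eq tip-side
        closer : co a j <[ e ] ext L a m (opposite e)
        closer = <-unflip (proj₂ on-m (opposite e))
        -- If the tip of `m` came as far as `z`, the ray from `z` towards `f` would meet `m` before
        -- its wall.
        side : ext L a m (opposite e) <[ e ] along a z
        side with <[]? e (ext L a m (opposite e)) (along a z)
        ... | yes p = p
        ... | no ¬p = contradiction m-past
                (wall-first f m (⟂-sym a⟂b) (proj₁ on-m) reaches (<⇒≤ m-before))
          where
          reaches : Reaches L a m (along a z)
          reaches g with End-cases e g
          ... | inj₁ refl = <⇒≤ (<-≤-trans (proj₂ on-m e) before-z)
          ... | inj₂ refl = ≤-flip ¬p

      closer-isStrictPartialOrder : ∀ a e →
        IsStrictPartialOrder _≡_ (λ i j → co a j <[ e ] co a i)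
      closer-isStrictPartialOrder a e = record
        { isEquivalence = isEquivalence
        ; irrefl = λ { refl → <-irrefl Eq.refl }
        ; trans = λ p q → <-trans q p
        ; <-resp-≈ = (λ { refl p → p }) , (λ { refl p → p }) }

      ¬enters : ∀ {a b e f} j → a ⟂ b → ¬ Enters a b e f j
      ¬enters {a} {b} {e} {f} j a⟂b =
        go j (spo-wellFounded (closer-isStrictPartialOrder a e) j)
        where
        go : ∀ j → Acc (λ i j → co a j <[ e ] co a i) j → ¬ Enters a b e f j
        go j (acc rs) ent with enters-step j a⟂b ent
        ... | m , ent₁ , _ , closer with enters-step m (⟂-sym a⟂b) ent₁
        ...   | k , ent₂ , eq , _ =
          go k (rs (<-respʳ (Eq.reflexive (sym eq)) closer)) ent₂

      -- The candidate for the face around `z` is the box cut out by the four rays from `z`. The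
      -- rays control only the two lines through `z`; the rest of the box is handled by `¬enters`.
      cell : Rectangle
      cell = record
        { left = wall horizontal low ; right = wall horizontal high
        ; bottom = wall vertical low ; top = wall vertical high
        ; left<right = from-< (<-trans (wall< horizontal low) (<-unflip (wall< horizontal high)))
        ; bottom<top = from-< (<-trans (wall< vertical low) (<-unflip (wall< vertical high))) }

      bound-cell : ∀ a e → bound cell a e ≡ wall a e
      bound-cell horizontal low  = refl
      bound-cell horizontal high = refl
      bound-cell vertical   low  = refl
      bound-cell vertical   high = refl

      wall≤ : ∀ {w} → w ∈ᴿ cell → ∀ a e → wall a e ≤[ e ] along a w
      wall≤ p a e = subst (_≤[ e ] _) (bound-cell a e) (∈ᴿ⇒ p a e)

      z∈cell : z ∈ᴿ° cell
      z∈cell = ⇒∈ᴿ° λ a e → subst (_<[ e ] _) (sym (bound-cell a e)) (wall< a e)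

      cell-within : ∀ w → w ∈ᴿ cell → w ∈ᴿ R
      cell-within w p = ⇒∈ᴿ λ a e →
        ≤-trans (bound≤pos a e (Ray.hit (cellRay a e))) (wall≤ p a e)

      -- A segment meeting the interior either comes as far as `z` and would stop a ray before its
      -- wall, or has a tip short of `z` inside the cell, which `¬enters` excludes. The side of `z`
      -- on which its line lies picks the ray.
      cell-empty : ∀ w → w ∈ᴿ° cell → ∀ i → ¬ w ∈ˢ segment i
      cell-empty w w∈ i w∈i = excluded
        where
        b = ax L i
        a = perp b
        a⟂b : a ⟂ b
        a⟂b = ⟂-sym (⟂-perp b)
        on-i = ∈segment⇒ i (⟂-perp b) refl w∈i
        wall<w : ∀ d e → wall d e <[ e ] along d w
        wall<w d e = subst (_<[ e ] _) (bound-cell d e) (∈ᴿ°⇒ w∈ d e)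
        tip : ∀ e f → co a i ≤[ e ] along a z → ¬ ext L b i (opposite f) <[ f ] along b z
        tip e f p q = ¬enters {e = e} {f} i a⟂b record
          { axis-b = refl ; past-wall = <-respʳ (proj₁ on-i) (wall<w a e) ; before-z = p
          ; tip-past = <-≤-trans (wall<w b f) (≤-unflip (proj₂ on-i (opposite f)))
          ; tip-side = q }
        at : ∀ e → ¬ co a i ≤[ e ] along a z
        at e p = wall-first e i a⟂b refl
          (λ { low → ≤-unflip (tip e high p) ; high → ≤-flip (tip e low p) }) p
          (<-respʳ (proj₁ on-i) (wall<w a e))
        excluded : ⊥
        excluded with ≤-total low (co a i) (along a z)
        ... | inj₁ p = at low p
        ... | inj₂ p = at high (≤-flip p)

      -- If `m` ended short of a corner, it would end on some `k` inside the wall of the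
      -- neighbouring ray. Either the tip of `k` lies before `z`, against `¬enters`, or `k` passes
      -- `z` and would stop that ray earlier.
      wall-covers : ∀ {a b} e m → a ⟂ b → Ray.hit (cellRay a e) ≡ just m →
                    ax L m ≡ b × (∀ g → ext L b m g ≤[ g ] wall b g)
      wall-covers {a} {b} e m a⟂b eq = proj₁ on-m , covers
        where
        on-m : ax L m ≡ b × Reaches L b m (along b z)
        on-m rewrite ⟂⇒perp a⟂b = Ray.hits (cellRay a e) m eq
        wall≡ : wall a e ≡ co a m
        wall≡ = cong (pos a e) eq
        covers : ∀ g → ext L b m g ≤[ g ] wall b g
        covers g p with halt L m g in eq′
        ... | nothing = bound≤pos b g (Ray.hit (cellRay b g)) p
        ... | just k with lands v m k (⟂-sym a⟂b) (proj₁ on-m) eq′ | proj₂ on-m g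
        ...   | axis-k , across-k | k≤z rewrite eq′ with <[]? e (ext L a k (opposite e)) (along a z)
        ...     | yes q = ¬enters {e = g} {e} k (⟂-sym a⟂b) record
                  { axis-b = axis-k ; past-wall = p ; before-z = k≤z
                  ; tip-past = <-respˡ (Eq.reflexive (sym wall≡)) (<-unflip (across-k (opposite e)))
                  ; tip-side = q }
        ...     | no ¬q = wall-first g k (⟂-sym a⟂b) axis-k reaches k≤z p
          where
          reaches : Reaches L a k (along a z)
          reaches h with End-cases e h
          ... | inj₁ refl = <⇒≤ (<-trans (across-k e) (<-respˡ (Eq.reflexive wall≡) (wall< a e)))
          ... | inj₂ refl = ≤-flip ¬q

      cell-walled : ∀ w → w ∈∂ cell → w ∈∂ R ⊎ (∃[ i ] w ∈ˢ segment i)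
      cell-walled w w∈ with ∈∂⇒ w∈
      ... | a , e , p = by (Ray.hit (cellRay a e)) refl
        where
        q : along a w ≈ wall a e
        q = Eq.trans p (Eq.reflexive (bound-cell a e))
        by : ∀ m → Ray.hit (cellRay a e) ≡ m → w ∈∂ R ⊎ (∃[ i ] w ∈ˢ segment i)
        by nothing  eq = inj₁ (⇒∈∂ (cell-within w (proj₁ w∈)) a e
          (Eq.trans q (Eq.reflexive (cong (pos a e) eq))))
        by (just m) eq with wall-covers e m (⟂-perp a) eq
        ... | axis-m , covers = inj₂ (m , ⇒∈segment m (⟂-sym (⟂-perp a)) axis-m
          (Eq.trans q (Eq.reflexive (cong (pos a e) eq)))
          (λ g → ≤-trans (covers g) (wall≤ (proj₁ w∈) (perp a) g)))

    ⟦_⟧ : Rectangulation R P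
    ⟦_⟧ = record
      { seg = segment
      ; through = λ i → ⇒∈segment° i (⟂-perp _) refl Eq.refl (through v i refl)
      ; only = λ i j p → co-injective (perp (ax L i)) (proj₁ (∈segment⇒ i (⟂-perp _) refl p))
      ; within = segment-within
      ; noncrossing = noncrossing
      ; ends = ends
      ; subdivision = λ z z∈R z∉ → let open Cell z z∈R z∉ in
          cell , z∈cell , record { within = cell-within ; empty = cell-empty ; walled = cell-walled }
      }
      where
      noncrossing : ∀ i j → i ≢ j → ∀ z → z ∈ˢ° segment i → ¬ z ∈ˢ° segment j
      noncrossing i j i≢j z p q with ∈segment°⇒ i (⟂-perp _) refl p | ⟂-cases (⟂-perp (ax L i)) (ax L j)
      ... | r , s | inj₁ t =
        i≢j (co-injective (perp (ax L i)) (Eq.trans (Eq.sym r) (proj₁ (∈segment°⇒ j (⟂-perp _) t q))))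
      ... | r , s | inj₂ t with ∈segment°⇒ j (⟂-sym (⟂-perp _)) t q
      ...   | r′ , s′ = nocross v i j (⟂-perp _) refl t
        (λ e → <-respʳ r′ (s e)) (λ e → <-respʳ r (s′ e))

      ends : ∀ i e → endpoint (segment i) e ∈∂ R ⊎
             (∃[ j ] axis (segment j) ≡ perp (axis (segment i)) × endpoint (segment i) e ∈ˢ° segment j)
      ends i e with halt L i e in eq
      ... | nothing = inj₁ (⇒∈∂ (segment-within i _ (endpoint∈segment i e)) (ax L i) e
        (Eq.reflexive (trans (along-endpoint-segment i e refl) (cong (pos (ax L i) e) eq))))
      ... | just j with lands v i j (⟂-perp _) refl eq
      ...   | p , q = inj₂ (j , p , ⇒∈segment° j (⟂-sym (⟂-perp _)) p
        (Eq.reflexive (trans (along-endpoint-segment i e refl) (cong (pos (ax L i) e) eq)))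
        (λ g → <-respʳ (Eq.reflexive (sym (along-endpoint-segment-⟂ i e (⟂-perp _) refl))) (q g)))

  -- Every rectangulation comes from a valid layout

  module Read (r : Rectangulation R P) where

    private module r = Rectangulation r

    level≈ : ∀ {a b} i → a ⟂ b → axis (seg r i) ≡ a → level (seg r i) ≈ co b i
    level≈ i a⟂b p = Eq.sym (proj₁ (∈ˢ°⇒ (seg r i) a⟂b p (r.through i)))

    end<co : ∀ {a} i → axis (seg r i) ≡ a → ∀ g → end (seg r i) g <[ g ] co a i
    end<co i p = proj₂ (∈ˢ°⇒ (seg r i) (⟂-perp _) p (r.through i))

    -- The disjunction is an argument, so that matching on `r.ends i e` inside a proof makes `halt`
    -- compute.
    haltOf : ∀ i e → endpoint (seg r i) e ∈∂ R ⊎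
             (∃[ j ] axis (seg r j) ≡ perp (axis (seg r i)) × endpoint (seg r i) e ∈ˢ° seg r j) →
             Maybe (Fin n)
    haltOf i e (inj₁ _)       = nothing
    haltOf i e (inj₂ (j , _)) = just j

    readLayout : Layout
    readLayout = record { ax = λ i → axis (seg r i) ; halt = λ i e → haltOf i e (r.ends i e) }

    -- An end on the boundary lies on the side that it faces: on a side parallel to the segment,
    -- `P i` would be on the boundary too, and on the side behind, `P i` would be outside `R`.
    end≈ext : ∀ {a} i e → axis (seg r i) ≡ a → end (seg r i) e ≈ ext readLayout a i e
    end≈ext {a} i e p with r.ends i e
    ... | inj₂ (j , q , on-j) =
          Eq.trans (Eq.reflexive (sym (along-endpoint (seg r i) e p)))
            (Eq.trans (proj₁ (∈ˢ°⇒ (seg r j) (⟂-sym (⟂-perp a)) (trans q (cong perp p)) on-j))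
              (level≈ j (⟂-sym (⟂-perp a)) (trans q (cong perp p))))
    ... | inj₁ on-∂ with ∈∂⇒ on-∂
    ...   | d , g , q with ⟂-cases (⟂-perp a) d
    ...     | inj₂ refl = contradiction (bound<co (perp a) g i) (<-irrefl (Eq.trans (Eq.sym q)
                (Eq.trans (Eq.reflexive (along-endpoint-⟂ (seg r i) e (⟂-perp a) p))
                  (level≈ i (⟂-perp a) p))))
    ...     | inj₁ refl with End-cases e g
    ...       | inj₁ refl = Eq.trans (Eq.reflexive (sym (along-endpoint (seg r i) e p))) q
    ...       | inj₂ refl = contradiction (end<co i p e) (<-asym (<-respʳ
                (Eq.trans (Eq.sym q) (Eq.reflexive (along-endpoint (seg r i) e p)))
                (<-unflip (bound<co a (opposite e) i))))

    crosses⇒ : ∀ {a b} i j → a ⟂ b → axis (seg r i) ≡ a → Crosses readLayout a i (co a j) →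
               point a (co a j) (co b i) ∈ˢ° seg r i
    crosses⇒ {a} {b} i j a⟂b p q = ⇒∈ˢ° (seg r i) a⟂b p
      (Eq.trans (Eq.reflexive (along-point-⟂ a⟂b _ _)) (Eq.sym (level≈ i a⟂b p)))
      (λ g → <-respʳ (Eq.reflexive (sym (along-point {a} _ _)))
               (<-respˡ (Eq.sym (end≈ext i g p)) (q g)))

    read-valid : Valid readLayout
    read-valid = record { through = thr ; lands = lnd ; nocross = nox }
      where
      thr : ∀ {a} i → axis (seg r i) ≡ a → Crosses readLayout a i (co a i)
      thr i p g = <-respˡ (end≈ext i g p) (end<co i p g)

      lnd : ∀ {a b e} i j → a ⟂ b → axis (seg r i) ≡ a → halt readLayout i e ≡ just j →
            axis (seg r j) ≡ b × Crosses readLayout b j (co b i)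
      lnd {a} {b} {e} i j a⟂b p eq with r.ends i e | eq
      ... | inj₂ (.j , q , on-j) | refl = axis-j , λ g →
              <-respʳ (Eq.trans (Eq.reflexive (along-endpoint-⟂ (seg r i) e a⟂b p)) (level≈ i a⟂b p))
                (<-respˡ (end≈ext j g axis-j) (proj₂ (∈ˢ°⇒ (seg r j) (⟂-sym a⟂b) axis-j on-j) g))
        where
        axis-j : axis (seg r j) ≡ b
        axis-j = trans q (trans (cong perp p) (sym (⟂⇒perp a⟂b)))

      nox : ∀ {a b} i j → a ⟂ b → axis (seg r i) ≡ a → axis (seg r j) ≡ b →
            Crosses readLayout a i (co a j) → ¬ Crosses readLayout b j (co b i)
      nox i j a⟂b p q x y = r.noncrossing i j (λ { refl → ⟂⇒≢ a⟂b (trans (sym p) q) })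
        _ (crosses⇒ i j a⟂b p x)
        (subst (_∈ˢ° seg r j) (point-swap (⟂-sym a⟂b) _ _) (crosses⇒ j i (⟂-sym a⟂b) q y))

    read-≋ : r ≋ ⟦ read-valid ⟧
    read-≋ i = refl , level≈ i (⟂-perp _) refl , end≈ext i low refl , end≈ext i high refl

  -- The closed and the open condition differ only when an end lies on the line of `i`, and by
  -- `pos≈co` such an end halts at `i`.
  reaches⇒crosses : ∀ {L a j} i → Reaches L a j (co a i) → (∀ g → halt L j g ≢ just i) →
                    Crosses L a j (co a i)
  reaches⇒crosses {L} {a} {j} i r ¬h g with ≤-split (r g)
  ... | inj₁ p = p
  ... | inj₂ p = contradiction (pos≈co (halt L j g) p) (¬h g)

  ∈∂⇒¬inside : ∀ {z} → z ∈∂ R → ¬ (∀ a e → bound R a e <[ e ] along a z)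
  ∈∂⇒¬inside z∈ p with ∈∂⇒ z∈
  ... | a , e , q = <-irrefl (Eq.sym q) (p a e)

  ¬∂-crosses : ∀ {L a b z} i → a ⟂ b → along b z ≈ co b i → Crosses L a i (along a z) → ¬ z ∈∂ R
  ¬∂-crosses {L} {a} {b} {z} i a⟂b p q z∈ = ∈∂⇒¬inside z∈ λ d e → inside d e (⟂-cases a⟂b d)
    where
    inside : ∀ d e → d ≡ a ⊎ d ≡ b → bound R d e <[ e ] along d z
    inside d e (inj₁ refl) = ≤-<-trans (bound≤pos a e (halt L i e)) (q e)
    inside d e (inj₂ refl) = <-respʳ (Eq.sym p) (bound<co b e i)

  Crosses-halt : ∀ {L L′ a j} {t} → (∀ g → halt L′ j g ≡ halt L j g) → Crosses L a j t → Crosses L′ a j t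
  Crosses-halt {a = a} p q g = subst (λ m → pos a g m <[ g ] _) (sym (p g)) (q g)

  Reaches-halt : ∀ {L L′ a j} {t} → (∀ g → halt L′ j g ≡ halt L j g) → Reaches L a j t → Reaches L′ a j t
  Reaches-halt {a = a} p q g = subst (λ m → pos a g m ≤[ g ] _) (sym (p g)) (q g)

  segment-cong : ∀ {L L′} (v : Valid L) (v′ : Valid L′) j → ax L′ j ≡ ax L j →
                 (∀ g → halt L′ j g ≡ halt L j g) → segment v′ j ≈ˢ segment v j
  segment-cong v v′ j p q rewrite p | q low | q high = refl , Eq.refl , Eq.refl , Eq.refl

  -- Flips and rotations

  -- A flip described symmetrically in both layouts, so that it is reversible.
  record Turn (L : Layout) (p : Fin n) (L′ : Layout) : Set ℓ₂ where
    field
      {a b}      : Axis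
      a⟂b        : a ⟂ b
      ax-p       : ax L p ≡ a
      ax-p′      : ax L′ p ≡ b
      ax-same    : ∀ j → j ≢ p → ax L′ j ≡ ax L j
      halt-same  : ∀ j → j ≢ p → ∀ g → halt L′ j g ≡ halt L j g
      untouched  : ∀ j → j ≢ p → ∀ g → halt L j g ≢ just p
      clear      : ∀ j → j ≢ p → ax L j ≡ b → Crosses L a p (co a j) → ¬ Reaches L b j (co b p)
      clear′     : ∀ j → j ≢ p → ax L j ≡ a → Crosses L′ b p (co b j) → ¬ Reaches L a j (co a p)

  Turn-sym : ∀ {L p L′} → Turn L p L′ → Turn L′ p L
  Turn-sym {L} {p} {L′} t = record
    { a⟂b = ⟂-sym a⟂b ; ax-p = ax-p′ ; ax-p′ = ax-p
    ; ax-same = λ j q → sym (ax-same j q)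
    ; halt-same = λ j q g → sym (halt-same j q g)
    ; untouched = λ j q g x → untouched j q g (trans (sym (halt-same j q g)) x)
    ; clear = λ j q x y z → clear′ j q (trans (sym (ax-same j q)) x) y
        (Reaches-halt {L′} {L} (λ g → sym (halt-same j q g)) z)
    ; clear′ = λ j q x y z → clear j q (trans (sym (ax-same j q)) x) y
        (Reaches-halt {L′} {L} (λ g → sym (halt-same j q g)) z) }
    where open Turn t

  Turn⇒Flip : ∀ {L p L′} (v : Valid L) (v′ : Valid L′) → Turn L p L′ → Flip ⟦ v ⟧ p ⟦ v′ ⟧
  Turn⇒Flip {L} {p} {L′} v v′ t = record
    { free = free
    ; turned = trans ax-p′ (trans (⟂⇒perp a⟂b) (cong perp (sym ax-p)))
    ; reaches = reaches
    ; clear = clr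
    ; unchanged = λ j q → segment-cong v v′ j (ax-same j q) (halt-same j q) }
    where
    open Turn t
    free : ∀ j → j ≢ p → ∀ e → ¬ endpoint (segment v j) e ∈ˢ segment v p
    free j j≢p e x with ∈segment⇒ v p a⟂b ax-p x | ⟂-cases a⟂b (ax L j)
    ... | y , _ | inj₁ q = j≢p (co-injective b
            (Eq.trans (Eq.reflexive (sym (along-endpoint-segment-⟂ v j e a⟂b q))) y))
    ... | y , _ | inj₂ q = untouched j j≢p e (pos≈co (halt L j e)
            (Eq.trans (Eq.reflexive (sym (along-endpoint-segment v j e q))) y))

    reaches : ∀ e → Blocked ⟦ v ⟧ p (endpoint (segment v′ p) e)
    reaches e with halt L′ p e in eq
    ... | nothing = inj₁ (⇒∈∂ (segment-within v′ p _ (endpoint∈segment v′ p e)) b e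
      (Eq.reflexive (trans (along-endpoint-segment v′ p e ax-p′) (cong (pos b e) eq))))
    ... | just j with lands v′ p j (⟂-sym a⟂b) ax-p′ eq
    ...   | q , x = inj₂ (j , j≢p , ⇒∈segment v j a⟂b (trans (sym (ax-same j j≢p)) q)
      (Eq.reflexive (trans (along-endpoint-segment v′ p e ax-p′) (cong (pos b e) eq)))
      (λ g → ≤-trans (<⇒≤ (Crosses-halt {L′} {L} (λ h → sym (halt-same j j≢p h)) x g))
               (≈⇒≤ (Eq.reflexive (sym (along-endpoint-segment-⟂ v′ p e (⟂-sym a⟂b) ax-p′))))))
      where
      j≢p : j ≢ p
      j≢p refl = ⟂⇒≢ a⟂b (trans (sym q) ax-p′)

    clr : ∀ z → z ∈ˢ° segment v′ p → ¬ Blocked ⟦ v ⟧ p z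
    clr z z∈ blocked with ∈segment°⇒ v′ p (⟂-sym a⟂b) ax-p′ z∈ | blocked
    ... | x , y | inj₁ z∈∂ = ¬∂-crosses {L′} p (⟂-sym a⟂b) x y z∈∂
    ... | x , y | inj₂ (j , j≢p , z∈j) with ⟂-cases a⟂b (ax L j)
    ...   | inj₁ q with ∈segment⇒ v j a⟂b q z∈j
    ...     | x′ , y′ = clear′ j j≢p q (λ g → <-respʳ x′ (y g)) (λ g → ≤-trans (y′ g) (≈⇒≤ x))
    clr z z∈ blocked | x , y | inj₂ (j , j≢p , z∈j) | inj₂ q =
      j≢p (co-injective a (Eq.trans (Eq.sym (proj₁ (∈segment⇒ v j (⟂-sym a⟂b) q z∈j))) x))

  -- A rotation: the e-end of i moves in to the line of k, and the f-end of k
  -- moves out across i.  Exchanging (L , i , e) and (L′ , k , f) reverses it.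
  record Swap (L : Layout) (i k : Fin n) (e f : End) (L′ : Layout) : Set ℓ₂ where
    field
      {a b}     : Axis
      a⟂b       : a ⟂ b
      ax-i      : ax L i ≡ a
      ax-k      : ax L k ≡ b
      ax-same   : ∀ j → ax L′ j ≡ ax L j
      halt-k    : halt L k f ≡ just i
      halt-i′   : halt L′ i e ≡ just k
      halt-same : ∀ j g → ¬ (j ≡ i × g ≡ e) → ¬ (j ≡ k × g ≡ f) → halt L′ j g ≡ halt L j g
      end<k     : ext L a i e <[ e ] co a k
      k<i       : co a k <[ e ] co a i
      end<i     : ext L′ b k f <[ f ] co b i
      i<k       : co b i <[ f ] co b k
      clear     : ∀ j → ax L j ≡ b → ext L a i e <[ e ] co a j → co a j <[ e ] co a k →
                  ¬ Reaches L b j (co b i)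
      clear′    : ∀ j → ax L j ≡ a → ext L′ b k f <[ f ] co b j → co b j <[ f ] co b i →
                  ¬ Reaches L a j (co a k)

    i≢k : i ≢ k
    i≢k refl = ⟂⇒≢ a⟂b (trans (sym ax-i) ax-k)

    halt-other : ∀ j → j ≢ i → j ≢ k → ∀ g → halt L′ j g ≡ halt L j g
    halt-other j p q g = halt-same j g (λ { (r , _) → p r }) (λ { (r , _) → q r })

    halt-i-opposite : halt L′ i (opposite e) ≡ halt L i (opposite e)
    halt-i-opposite = halt-same i (opposite e) (λ { (_ , q) → opposite-≢ e q }) (λ { (q , _) → i≢k q })

    halt-k-opposite : halt L′ k (opposite f) ≡ halt L k (opposite f)
    halt-k-opposite = halt-same k (opposite f) (λ { (q , _) → i≢k (sym q) }) (λ { (_ , q) → opposite-≢ f q })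

  Swap-sym : ∀ {L i k e f L′} → Swap L i k e f L′ → Swap L′ k i f e L
  Swap-sym {L} {i} {k} {e} {f} {L′} s = record
    { a⟂b = ⟂-sym a⟂b
    ; ax-i = trans (ax-same k) ax-k ; ax-k = trans (ax-same i) ax-i
    ; ax-same = λ j → sym (ax-same j)
    ; halt-k = halt-i′ ; halt-i′ = halt-k
    ; halt-same = λ j g p q → sym (halt-same j g q p)
    ; end<k = end<i ; k<i = i<k ; end<i = end<k ; i<k = k<i
    ; clear = λ j p q r x → clear′ j (trans (sym (ax-same j)) p) q r
        (Reaches-halt {L′} {L} (λ g → sym (halt-other j (λ { refl → <-irrefl Eq.refl r })
          (λ { refl → ⟂⇒≢ a⟂b (trans (sym p) (trans (ax-same k) ax-k)) }) g)) x)
    ; clear′ = λ j p q r x → clear j (trans (sym (ax-same j)) p) q r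
        (Reaches-halt {L′} {L} (λ g → sym (halt-other j
          (λ { refl → ⟂⇒≢ (⟂-sym a⟂b) (trans (sym p) (trans (ax-same i) ax-i)) })
          (λ { refl → <-irrefl Eq.refl r }) g)) x) }
    where open Swap s

  Swap⇒Rotate : ∀ {L i k e f L′} (v : Valid L) (v′ : Valid L′) → Swap L i k e f L′ →
                Rotate ⟦ v ⟧ i k e f ⟦ v′ ⟧
  Swap⇒Rotate {L} {i} {k} {e} {f} {L′} v v′ s = record
    { distinct = λ p → i≢k (sym p)
    ; c∈ap = ⇒box a⟂b
        (⇒Between e (≤-trans (≈⇒≤ A-a) (<⇒≤ (<-respʳ (Eq.sym C-a) end<k)))
                    (≤-trans (≈⇒≤ C-a) (<⇒≤ k<i)))
        (⇒Between e (≈⇒≤ (Eq.trans A-b (Eq.sym C-b))) (≈⇒≤ C-b))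
    ; c∈s₁ = ⇒∈segment v i a⟂b ax-i C-b λ g → ≤-trans (<⇒≤ (i-crosses g)) (≈⇒≤ (Eq.sym C-a))
    ; ac-free = ac-free
    ; axis₁ = ax-same i
    ; shortened = ⇒≈ᵖ a⟂b
        (Eq.trans (Eq.reflexive (trans (along-endpoint-segment v′ i e ax-i′) (cong (pos a e) halt-i′)))
          (Eq.sym C-a))
        (Eq.trans (Eq.reflexive (along-endpoint-segment-⟂ v′ i e a⟂b ax-i′)) (Eq.sym C-b))
    ; keeps-b = ⇒≈ᵖ a⟂b
        (Eq.reflexive (trans (along-endpoint-segment v′ i (opposite e) ax-i′)
          (trans (cong (pos a (opposite e)) halt-i-opposite)
            (sym (along-endpoint-segment v i (opposite e) ax-i)))))
        (Eq.reflexive (trans (along-endpoint-segment-⟂ v′ i (opposite e) a⟂b ax-i′)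
            (sym (along-endpoint-segment-⟂ v i (opposite e) a⟂b ax-i))))
    ; axis₂ = ax-same k
    ; keeps-d = ⇒≈ᵖ (⟂-sym a⟂b)
        (Eq.reflexive (trans (along-endpoint-segment v′ k (opposite f) ax-k′)
          (trans (cong (pos b (opposite f)) halt-k-opposite)
            (sym (along-endpoint-segment v k (opposite f) ax-k)))))
        (Eq.reflexive (trans (along-endpoint-segment-⟂ v′ k (opposite f) (⟂-sym a⟂b) ax-k′)
            (sym (along-endpoint-segment-⟂ v k (opposite f) (⟂-sym a⟂b) ax-k))))
    ; beyond-c = ⇒∈segment° v′ k (⟂-sym a⟂b) ax-k′ C-a λ g → <-respʳ (Eq.sym C-b) (k-crosses g)
    ; reaches = reaches
    ; clear = clr
    ; unchanged = λ j p q → segment-cong v v′ j (ax-same j) (halt-other j p q) }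
    where
    open Swap s
    ax-i′ : ax L′ i ≡ a
    ax-i′ = trans (ax-same i) ax-i
    ax-k′ : ax L′ k ≡ b
    ax-k′ = trans (ax-same k) ax-k

    A C : Point
    A = endpoint (segment v i) e
    C = endpoint (segment v k) f
    A-a : along a A ≈ ext L a i e
    A-a = Eq.reflexive (along-endpoint-segment v i e ax-i)
    A-b : along b A ≈ co b i
    A-b = Eq.reflexive (along-endpoint-segment-⟂ v i e a⟂b ax-i)
    C-a : along a C ≈ co a k
    C-a = Eq.reflexive (along-endpoint-segment-⟂ v k f (⟂-sym a⟂b) ax-k)
    C-b : along b C ≈ co b i
    C-b = Eq.reflexive (trans (along-endpoint-segment v k f ax-k) (cong (pos b f) halt-k))

    i-crosses : Crosses L a i (co a k)
    i-crosses g with End-cases e g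
    ... | inj₁ refl = end<k
    ... | inj₂ refl = <-trans (through v i ax-i (opposite e)) (<-flip k<i)

    k-crosses : Crosses L′ b k (co b i)
    k-crosses g with End-cases f g
    ... | inj₁ refl = end<i
    ... | inj₂ refl = <-trans (through v′ k ax-k′ (opposite f)) (<-flip i<k)

    ac-free : ∀ j → j ≢ i → j ≢ k → ∀ g → ¬ endpoint (segment v j) g ∈[ A , C ]
    ac-free j j≢i j≢k g x with ⟂-cases a⟂b (ax L j)
    ... | inj₁ p with Between⇒ e (≈⇒≤ (Eq.trans A-b (Eq.sym C-b))) (box⇒ x b)
    ...   | q , r = j≢i (co-injective b (Eq.trans
              (Eq.reflexive (sym (along-endpoint-segment-⟂ v j g a⟂b p)))
              (≤-antisym (≤-trans r (≈⇒≤ C-b)) (≤-trans (≈⇒≤ (Eq.sym A-b)) q))))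
    ac-free j j≢i j≢k g x | inj₂ p
      with Between⇒ e (≈⇒≤ (Eq.trans A-b (Eq.sym C-b))) (box⇒ x b)
         | Between⇒ e (≤-trans (≈⇒≤ A-a) (<⇒≤ (<-respʳ (Eq.sym C-a) end<k))) (box⇒ x a)
    ... | q , r | q′ , r′ = meets
      where
      E-b : ext L b j g ≈ co b i
      E-b = Eq.trans (Eq.reflexive (sym (along-endpoint-segment v j g p)))
        (≤-antisym (≤-trans r (≈⇒≤ C-b)) (≤-trans (≈⇒≤ (Eq.sym A-b)) q))
      E-a = Eq.reflexive (along-endpoint-segment-⟂ v j g (⟂-sym a⟂b) p)
      A≤ : ext L a i e ≤[ e ] co a j
      A≤ = ≤-trans (≈⇒≤ (Eq.sym A-a)) (≤-trans q′ (≈⇒≤ E-a))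
      ≤C : co a j ≤[ e ] co a k
      ≤C = ≤-trans (≈⇒≤ (Eq.sym E-a)) (≤-trans r′ (≈⇒≤ C-a))
      reach : Reaches L b j (co b i)
      reach h with End-cases g h
      ... | inj₁ refl = ≈⇒≤ E-b
      ... | inj₂ refl = <⇒≤ (<-respʳ E-b (<-trans (through v j p (opposite g))
              (<-flip (through v j p g))))
      meets : ⊥
      meets with ≤-split A≤ | ≤-split ≤C
      ... | _       | inj₂ y = j≢k (co-injective a y)
      ... | inj₁ y  | inj₁ z = clear j p y z reach
      -- At `A` itself, `i` halts at `j`, and `lands` puts this point in the relative interior of
      -- `j`, so no end of `j` is there.
      ... | inj₂ y  | inj₁ z = <-irrefl E-b
              (proj₂ (lands v i j a⟂b ax-i (pos≈co (halt L i e) y)) g)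

    reaches : Blocked ⟦ v ⟧ k (endpoint (segment v′ k) f)
    reaches with halt L′ k f in eq
    ... | nothing = inj₁ (⇒∈∂ (segment-within v′ k _ (endpoint∈segment v′ k f)) b f
      (Eq.reflexive (trans (along-endpoint-segment v′ k f ax-k′) (cong (pos b f) eq))))
    ... | just j with lands v′ k j (⟂-sym a⟂b) ax-k′ eq
    ...   | q , x = inj₂ (j , j≢k , ⇒∈segment v j a⟂b (trans (sym (ax-same j)) q)
      (Eq.reflexive (trans (along-endpoint-segment v′ k f ax-k′) (cong (pos b f) eq)))
      (λ g → ≤-trans (<⇒≤ (Crosses-halt {L′} {L} (λ h → sym (halt-other j j≢i j≢k h)) x g))
        (≈⇒≤ (Eq.reflexive (sym (along-endpoint-segment-⟂ v′ k f (⟂-sym a⟂b) ax-k′))))))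
      where
      j≢k : j ≢ k
      j≢k refl = ⟂⇒≢ a⟂b (trans (sym q) ax-k′)
      j≢i : j ≢ i
      j≢i refl = <-irrefl (Eq.reflexive (cong (pos b f) eq)) end<i

    clr : ∀ z → z ∈ˢ° segment v′ k → ¬ z ∈ˢ segment v k → ¬ Blocked ⟦ v ⟧ k z
    clr z z∈ z∉ blocked with ∈segment°⇒ v′ k (⟂-sym a⟂b) ax-k′ z∈ | blocked
    ... | x , y | inj₁ z∈∂ = ¬∂-crosses {L′} k (⟂-sym a⟂b) x y z∈∂
    ... | x , y | inj₂ (j , j≢k , z∈j) with ⟂-cases a⟂b (ax L j)
    ...   | inj₂ q = j≢k (co-injective a
              (Eq.trans (Eq.sym (proj₁ (∈segment⇒ v j (⟂-sym a⟂b) q z∈j))) x))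
    ...   | inj₁ q with ∈segment⇒ v j a⟂b q z∈j
    ...     | x′ , y′ = clear′ j q (<-respʳ x′ (y f)) (<-respˡ x′ z<i) (λ g → ≤-trans (y′ g) (≈⇒≤ x))
      where
      -- A point of the new segment that is not on the old one lies strictly beyond the line of `i`,
      -- where `clear′` applies.
      z<i : along b z <[ f ] co b i
      z<i with <[]? f (along b z) (co b i)
      ... | yes p = p
      ... | no ¬p = contradiction (⇒∈segment v k (⟂-sym a⟂b) ax-k x reach) z∉
        where
        reach : Reaches L b k (along b z)
        reach g with End-cases f g
        ... | inj₁ refl = ≤-trans (≈⇒≤ (Eq.reflexive (cong (pos b f) halt-k))) ¬p
        ... | inj₂ refl = <⇒≤ (subst (λ m → pos b (opposite f) m <[ opposite f ] along b z)
                halt-k-opposite (y (opposite f)))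

  -- Existence of the moves

  touches : ∀ {L a b} i j → a ⟂ b → Reaches L b j (co b i) → ¬ Crosses L b j (co b i) →
            ∃[ g ] halt L j g ≡ just i
  touches {L} i j a⟂b r ¬c with ≡-dec Fin._≟_ (halt L j low) (just i) | ≡-dec Fin._≟_ (halt L j high) (just i)
  ... | yes p | _     = low , p
  ... | no _  | yes q = high , q
  ... | no p  | no q  = contradiction (reaches⇒crosses {L} i r λ { low → p ; high → q }) ¬c

  module _ {A : Set} (h : Fin n → End → A) (i : Fin n) (e : End) (m : A) where

    set : Fin n → End → A
    set j g with j Fin.≟ i | g ≟ᴱ e
    ... | yes _ | yes _ = m
    ... | _     | _     = h j g

    set-updates : set i e ≡ m
    set-updates with i Fin.≟ i | e ≟ᴱ e
    ... | yes _ | yes _ = refl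
    ... | no p  | _     = contradiction refl p
    ... | yes _ | no p  = contradiction refl p

    set-minimal : ∀ j g → ¬ (j ≡ i × g ≡ e) → set j g ≡ h j g
    set-minimal j g p with j Fin.≟ i | g ≟ᴱ e
    ... | yes q | yes r = contradiction (q , r) p
    ... | yes _ | no _  = refl
    ... | no _  | _     = refl

  -- Since no end halts at `p`, only the ends of `p` itself need new obstacles, and rays from `P p`
  -- along the new axis find them.
  module MakeTurn {L : Layout} (v : Valid L) (p : Fin n) {a b : Axis} (a⟂b : a ⟂ b)
    (ax-p : ax L p ≡ a) (untouched : ∀ j g → halt L j g ≢ just p) where

    rayFrom : ∀ g → Ray L b a g (co b p) (co a p)
    rayFrom g = ray L b a g (co a p) (bound<co b g p)

    turned : Layout
    turned = record { ax = ax′ ; halt = halt′ }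
      where
      ax′ : Fin n → Axis
      ax′ j with j Fin.≟ p
      ... | yes _ = b
      ... | no _  = ax L j
      halt′ : Fin n → End → Maybe (Fin n)
      halt′ j g with j Fin.≟ p
      ... | yes _ = Ray.hit (rayFrom g)
      ... | no _  = halt L j g

    ax-p′ : ax turned p ≡ b
    ax-p′ with p Fin.≟ p
    ... | yes _ = refl
    ... | no q  = contradiction refl q

    halt-p′ : ∀ g → halt turned p g ≡ Ray.hit (rayFrom g)
    halt-p′ g with p Fin.≟ p
    ... | yes _ = refl
    ... | no q  = contradiction refl q

    ax-same : ∀ j → j ≢ p → ax turned j ≡ ax L j
    ax-same j q with j Fin.≟ p
    ... | yes r = contradiction r q
    ... | no _  = refl

    halt-same : ∀ j → j ≢ p → ∀ g → halt turned j g ≡ halt L j g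
    halt-same j q g with j Fin.≟ p
    ... | yes r = contradiction r q
    ... | no _  = refl

    clear′ : ∀ j → j ≢ p → ax L j ≡ a → Crosses turned b p (co b j) → ¬ Reaches L a j (co a p)
    clear′ j j≢p q x r with <-compare low (co b j) (co b p)
    ... | tri≈ _ s _ = j≢p (co-injective b s)
    ... | tri< s _ _ = Ray.first (rayFrom low) j q r s
            (<-respˡ (Eq.reflexive (cong (pos b low) (halt-p′ low))) (x low))
    ... | tri> _ _ s = Ray.first (rayFrom high) j q r (<-flip s)
            (<-respˡ (Eq.reflexive (cong (pos b high) (halt-p′ high))) (x high))

    clear : ∀ j → j ≢ p → ax L j ≡ b → Crosses L a p (co a j) → ¬ Reaches L b j (co b p)
    clear j j≢p q x r with touches {L} p j a⟂b r (nocross v p j a⟂b ax-p q x)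
    ... | g , s = untouched j g s

    isTurn : Turn L p turned
    isTurn = record
      { a⟂b = a⟂b ; ax-p = ax-p ; ax-p′ = ax-p′ ; ax-same = ax-same ; halt-same = halt-same
      ; untouched = λ j _ → untouched j ; clear = clear ; clear′ = clear′ }

    turned-valid : Valid turned
    turned-valid = record { through = thr ; lands = lnd ; nocross = nox }
      where
      thr : ∀ {d} i → ax turned i ≡ d → Crosses turned d i (co d i)
      thr i q with i Fin.≟ p
      thr i refl | yes refl = λ g → Ray.beyond (rayFrom g)
      thr i q | no _ = through v i q

      lnd : ∀ {d d′ e} i j → d ⟂ d′ → ax turned i ≡ d → halt turned i e ≡ just j →
            ax turned j ≡ d′ × Crosses turned d′ j (co d′ i)
      lnd {e = e} i j d⟂d′ q r with i Fin.≟ p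
      lnd {e = e} i j d⟂d′ q r | no _ with lands v i j d⟂d′ q r
      ... | s , x = trans (ax-same j j≢p) s , Crosses-halt {L} {turned} (halt-same j j≢p) x
        where
        j≢p : j ≢ p
        j≢p refl = untouched i e r
      lnd {e = e} i j d⟂d′ refl r | yes refl
        rewrite ⟂-unique d⟂d′ (⟂-sym a⟂b) with Ray.hits (rayFrom e) j r
      ... | s , x = trans (ax-same j j≢p) s ,
                    Crosses-halt {L} {turned} (halt-same j j≢p) (reaches⇒crosses {L} i x (untouched j))
        where
        j≢p : j ≢ p
        j≢p refl = <-irrefl (Eq.reflexive (cong (pos b e) r)) (Ray.beyond (rayFrom e))

      nox₁ : ∀ i → i ≢ p → ax L i ≡ a → Crosses turned b p (co b i) → ¬ Crosses turned a i (co a p)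
      nox₁ i i≢p q x y = clear′ i i≢p q x
        λ g → <⇒≤ (Crosses-halt {turned} {L} (λ h → sym (halt-same i i≢p h)) y g)

      nox : ∀ {d d′} i j → d ⟂ d′ → ax turned i ≡ d → ax turned j ≡ d′ →
            Crosses turned d i (co d j) → ¬ Crosses turned d′ j (co d′ i)
      nox i j d⟂d′ q r x y = by (i Fin.≟ p) (j Fin.≟ p)
        where
        by : Dec (i ≡ p) → Dec (j ≡ p) → ⊥
        by (yes refl) (yes refl) = ⟂⇒≢ d⟂d′ (trans (sym q) r)
        by (yes refl) (no j≢p) with trans (sym q) ax-p′
        ... | refl rewrite ⟂-unique d⟂d′ (⟂-sym a⟂b) =
              nox₁ j j≢p (trans (sym (ax-same j j≢p)) r) x y
        by (no i≢p) (yes refl) with trans (sym r) ax-p′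
        ... | refl rewrite ⟂-unique (⟂-sym d⟂d′) (⟂-sym a⟂b) =
              nox₁ i i≢p (trans (sym (ax-same i i≢p)) q) y x
        by (no i≢p) (no j≢p) = nocross v i j d⟂d′
          (trans (sym (ax-same i i≢p)) q) (trans (sym (ax-same j j≢p)) r)
          (Crosses-halt {turned} {L} (λ h → sym (halt-same i i≢p h)) x)
          (Crosses-halt {turned} {L} (λ h → sym (halt-same j j≢p h)) y)

  -- `nearest` makes `k` the outermost segment ending on `i` on the `e`-side of `P i`. Every other
  -- end that lies on `i` then stays on the shortened segment.
  module MakeSwap {L : Layout} (v : Valid L) (i k : Fin n) (e f : End) {a b : Axis} (a⟂b : a ⟂ b)
    (ax-i : ax L i ≡ a) (halt-k : halt L k f ≡ just i) (k<i : co a k <[ e ] co a i)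
    (nearest : ∀ j g → halt L j g ≡ just i → co a j <[ e ] co a i → co a k ≤[ e ] co a j) where

    ax-k : ax L k ≡ b
    ax-k with ⟂-cases a⟂b (ax L k)
    ... | inj₂ p = p
    ... | inj₁ p = contradiction (trans (sym ax-i) (proj₁ (lands v k i a⟂b p halt-k))) (⟂⇒≢ a⟂b)

    i-crosses : Crosses L a i (co a k)
    i-crosses = proj₂ (lands v k i (⟂-sym a⟂b) ax-k halt-k)

    i<k : co b i <[ f ] co b k
    i<k = <-respˡ (Eq.reflexive (cong (pos b f) halt-k)) (through v k ax-k f)

    i≢k : i ≢ k
    i≢k refl = <-irrefl Eq.refl k<i

    extension : Ray L b a f (co b i) (co a k)
    extension = ray L b a f (co a k) (bound<co b f i)

    open Ray extension

    swapped : Layout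
    swapped = record { ax = ax L ; halt = set (set (halt L) k f hit) i e (just k) }

    halt-i′ : halt swapped i e ≡ just k
    halt-i′ = set-updates (set (halt L) k f hit) i e (just k)

    halt-k′ : halt swapped k f ≡ hit
    halt-k′ = trans (set-minimal (set (halt L) k f hit) i e (just k) k f (λ { (p , _) → i≢k (sym p) }))
                    (set-updates (halt L) k f hit)

    halt-same : ∀ j g → ¬ (j ≡ i × g ≡ e) → ¬ (j ≡ k × g ≡ f) → halt swapped j g ≡ halt L j g
    halt-same j g p q = trans (set-minimal (set (halt L) k f hit) i e (just k) j g p)
                              (set-minimal (halt L) k f hit j g q)

    end<i : ext swapped b k f <[ f ] co b i
    end<i = <-respˡ (Eq.reflexive (cong (pos b f) (sym halt-k′))) beyond

    changed? : ∀ j g → (j ≡ i × g ≡ e) ⊎ ((j ≡ k × g ≡ f) ⊎ halt swapped j g ≡ halt L j g)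
    changed? j g with (j Fin.≟ i) ×-dec (g ≟ᴱ e) | (j Fin.≟ k) ×-dec (g ≟ᴱ f)
    ... | yes p | _     = inj₁ p
    ... | no _  | yes q = inj₂ (inj₁ q)
    ... | no p  | no q  = inj₂ (inj₂ (halt-same j g p q))

    -- On axis `b` only `k` changes, and it extends; on axis `a` only `i` changes, and `shrink` is
    -- the dual statement. `grow` carries landings over to the new layout, `shrink` carries
    -- crossings back to the old one.
    grow : ∀ j {t} → ax L j ≡ b → Crosses L b j t → Crosses swapped b j t
    grow j p x g with changed? j g
    ... | inj₁ (refl , refl)        = contradiction (trans (sym ax-i) p) (⟂⇒≢ a⟂b)
    ... | inj₂ (inj₁ (refl , refl)) =
          <-trans end<i (<-respˡ (Eq.reflexive (cong (pos b f) halt-k)) (x f))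
    ... | inj₂ (inj₂ q)             = <-respˡ (Eq.reflexive (cong (pos b g) (sym q))) (x g)

    shrink : ∀ j {t} → ax L j ≡ a → Crosses swapped a j t → Crosses L a j t
    shrink j p x g with changed? j g
    ... | inj₁ (refl , refl)        =
          <-trans (i-crosses e) (<-respˡ (Eq.reflexive (cong (pos a e) halt-i′)) (x e))
    ... | inj₂ (inj₁ (refl , refl)) = contradiction (trans (sym p) ax-k) (⟂⇒≢ a⟂b)
    ... | inj₂ (inj₂ q)             = <-respˡ (Eq.reflexive (cong (pos a g) q)) (x g)

    k-crosses : Crosses swapped b k (co b i)
    k-crosses g with End-cases f g
    ... | inj₁ refl = end<i
    ... | inj₂ refl = <-trans
      (<-respˡ (Eq.reflexive (cong (pos b (opposite f))
        (sym (halt-same k (opposite f) (λ { (p , _) → i≢k (sym p) }) (λ { (_ , q) → opposite-≢ f q })))))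
        (through v k ax-k (opposite f)))
      (<-flip i<k)

    clear : ∀ j → ax L j ≡ b → ext L a i e <[ e ] co a j → co a j <[ e ] co a k →
            ¬ Reaches L b j (co b i)
    clear j p q r x with touches {L} i j a⟂b x (nocross v i j a⟂b ax-i p i-crosses-j)
      where
      i-crosses-j : Crosses L a i (co a j)
      i-crosses-j g with End-cases e g
      ... | inj₁ refl = q
      ... | inj₂ refl = <-trans (i-crosses (opposite e)) (<-flip r)
    ... | g , s = nearest j g s (<-trans r k<i) r

    clear′ : ∀ j → ax L j ≡ a → ext swapped b k f <[ f ] co b j → co b j <[ f ] co b i →
             ¬ Reaches L a j (co a k)
    clear′ j p q r x = first j p x r (<-respˡ (Eq.reflexive (cong (pos b f) halt-k′)) q)

    isSwap : Swap L i k e f swapped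
    isSwap = record
      { a⟂b = a⟂b ; ax-i = ax-i ; ax-k = ax-k ; ax-same = λ _ → refl ; halt-k = halt-k
      ; halt-i′ = halt-i′ ; halt-same = halt-same ; end<k = i-crosses e ; k<i = k<i
      ; end<i = end<i ; i<k = i<k ; clear = clear ; clear′ = clear′ }

    swapped-valid : Valid swapped
    swapped-valid = record { through = thr ; lands = lnd ; nocross = nox }
      where
      thr : ∀ {d} j → ax L j ≡ d → Crosses swapped d j (co d j)
      thr {d} j p with ⟂-cases a⟂b d
      ... | inj₂ refl = grow j p (through v j p)
      ... | inj₁ refl = λ g → at g (changed? j g)
        where
        at : ∀ g → (j ≡ i × g ≡ e) ⊎ ((j ≡ k × g ≡ f) ⊎ halt swapped j g ≡ halt L j g) →
             ext swapped a j g <[ g ] co a j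
        at g (inj₁ (refl , refl))        = <-respˡ (Eq.reflexive (cong (pos a e) (sym halt-i′))) k<i
        at g (inj₂ (inj₁ (refl , refl))) = contradiction (trans (sym p) ax-k) (⟂⇒≢ a⟂b)
        at g (inj₂ (inj₂ q))             =
          <-respˡ (Eq.reflexive (cong (pos a g) (sym q))) (through v j p g)

      keeps-touching : ∀ x g → halt L x g ≡ just i → ¬ (x ≡ k × g ≡ f) → Crosses L a i (co a x) →
                       Crosses swapped a i (co a x)
      keeps-touching x g p q cr h with changed? i h
      ... | inj₂ (inj₁ (r , _)) = contradiction r i≢k
      ... | inj₂ (inj₂ r)       = <-respˡ (Eq.reflexive (cong (pos a h) (sym r))) (cr h)
      ... | inj₁ (_ , refl) with ≤-split k≤x
        where
        k≤x : co a k ≤[ e ] co a x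
        k≤x with <[]? e (co a x) (co a i)
        ... | yes s = nearest x g p s
        ... | no ¬s = <⇒≤ (<-≤-trans k<i ¬s)
      ...   | inj₁ s = <-respˡ (Eq.reflexive (cong (pos a e) (sym halt-i′))) s
      -- An end lying on `i` at the line of `k` belongs to `k`. Were it not the `f`-end, both ends
      -- of `k` would lie on `i`, against `ext<opposite`.
      ...   | inj₂ s with co-injective a s | End-cases f g
      ...     | refl | inj₁ refl = contradiction (refl , refl) q
      ...     | refl | inj₂ refl = contradiction (ext<opposite v k ax-k f)
                (<-irrefl (Eq.reflexive (trans (cong (pos b f) halt-k) (sym (cong (pos b (opposite f)) p)))))

      -- The stopping segment `y` cannot end at the new tip of `k`: such an end would halt at `k`
      -- already in `L`, whereas `y` lies beyond `i`, where the old `k` does not extend.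
      hit-crosses : ∀ y → hit ≡ just y → ax L y ≡ a × Crosses swapped a y (co a k)
      hit-crosses y p = proj₁ (hits y p) ,
        Crosses-halt {L} {swapped} (λ g → halt-same y g (λ { (q , _) → y≢i q }) (λ { (q , _) → y≢k q }))
          (reaches⇒crosses {L} k (proj₂ (hits y p)) y-free)
        where
        y<i : co b y <[ f ] co b i
        y<i = <-respˡ (Eq.reflexive (cong (pos b f) p)) beyond
        y≢i : y ≢ i
        y≢i refl = <-irrefl Eq.refl y<i
        y≢k : y ≢ k
        y≢k refl = <-asym y<i i<k
        y-free : ∀ g → halt L y g ≢ just k
        y-free g q = <-asym y<i (<-respˡ (Eq.reflexive (cong (pos b f) halt-k))
          (proj₂ (lands v y k a⟂b (proj₁ (hits y p)) q) f))

      lnd : ∀ {d d′ g} x y → d ⟂ d′ → ax L x ≡ d → halt swapped x g ≡ just y →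
            ax L y ≡ d′ × Crosses swapped d′ y (co d′ x)
      lnd {g = g} x y d⟂d′ p q with (x Fin.≟ k) ×-dec (g ≟ᴱ f) | changed? x g
      ... | yes (refl , refl) | _ with trans (sym p) ax-k
      ...   | refl rewrite ⟂-unique d⟂d′ (⟂-sym a⟂b) = hit-crosses y (trans (sym halt-k′) q)
      lnd x y d⟂d′ p q | no r | inj₂ (inj₁ s) = contradiction s r
      lnd x y d⟂d′ p q | no r | inj₁ (refl , refl) with trans (sym halt-i′) q | trans (sym p) ax-i
      ...   | refl | refl rewrite ⟂-unique d⟂d′ a⟂b = ax-k , k-crosses
      lnd {d} {d′} {g} x y d⟂d′ p q | no r | inj₂ (inj₂ s)
        with lands v x y d⟂d′ p (trans (sym s) q) | ⟂-cases a⟂b d′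
      ...   | t , cr | inj₂ refl = t , grow y t cr
      ...   | t , cr | inj₁ refl = t , by (y Fin.≟ i)
        where
        by : Dec (y ≡ i) → Crosses swapped d′ y (co d′ x)
        by (yes refl) = keeps-touching x g (trans (sym s) q) r cr
        by (no y≢i)   = Crosses-halt {L} {swapped} (λ h → halt-same y h (λ { (u , _) → y≢i u })
          (λ { (refl , _) → ⟂⇒≢ a⟂b (trans (sym t) ax-k) })) cr

      -- Only `k` gains points, so only `y = k` needs a new argument. If `x` lies beyond `i`, the
      -- extension is clear up to `hit`; if `x` is `i`, it now ends at `k`; otherwise the crossing
      -- was already present in `L`.
      nox₁ : ∀ x y → ax L x ≡ a → ax L y ≡ b →
             Crosses swapped a x (co a y) → ¬ Crosses swapped b y (co b x)
      nox₁ x y p q cr cr′ with y Fin.≟ k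
      ... | no y≢k = nocross v x y a⟂b p q (shrink x p cr) (Crosses-halt {swapped} {L}
              (λ h → sym (halt-same y h (λ { (refl , _) → ⟂⇒≢ a⟂b (trans (sym ax-i) q) })
                                        (λ { (u , _) → y≢k u }))) cr′)
      ... | yes refl with <-compare f (co b x) (co b i)
      ...   | tri< r _ _ = clear′ x p (cr′ f) r (λ g → <⇒≤ (shrink x p cr g))
      ...   | tri≈ _ r _ with co-injective b r
      ...     | refl = <-irrefl (Eq.reflexive (cong (pos a e) halt-i′)) (cr e)
      nox₁ x y p q cr cr′ | yes refl | tri> _ _ r = nocross v x k a⟂b p q (shrink x p cr) old
        where
        old : Crosses L b k (co b x)
        old g with End-cases f g
        ... | inj₁ refl = <-respˡ (Eq.reflexive (cong (pos b f) (sym halt-k))) r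
        ... | inj₂ refl = <-respˡ (Eq.reflexive (cong (pos b (opposite f))
                (halt-same k (opposite f) (λ { (u , _) → i≢k (sym u) })
                                          (λ { (_ , u) → opposite-≢ f u })))) (cr′ (opposite f))

      nox : ∀ {d d′} x y → d ⟂ d′ → ax L x ≡ d → ax L y ≡ d′ →
            Crosses swapped d x (co d y) → ¬ Crosses swapped d′ y (co d′ x)
      nox {d} x y d⟂d′ p q cr cr′ with ⟂-cases a⟂b d
      ... | inj₁ refl rewrite ⟂-unique d⟂d′ a⟂b = nox₁ x y p q cr cr′
      ... | inj₂ refl rewrite ⟂-unique d⟂d′ (⟂-sym a⟂b) = nox₁ y x q p cr′ cr

  -- The greedy walk to the vertical rectangulation

  -- Both directions are carried along because `Walk` follows directed moves, and the final walk
  -- runs through one straightening forwards and another one backwards.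
  record Linked (d : ℕ) (r s : Rectangulation R P) : Set (c ⊔ ℓ₁ ⊔ ℓ₂) where
    constructor linked
    field
      there : ∃[ m ] m ≤ d × Walk m r s
      back  : ∃[ m ] m ≤ d × Walk m s r

  Linked-refl : ∀ {r} → Linked 0 r r
  Linked-refl {r} = linked (0 , z≤n , stop (≋-refl r)) (0 , z≤n , stop (≋-refl r))

  Linked-trans : ∀ {d d′ r s t} → Linked d r s → Linked d′ s t → Linked (d + d′) r t
  Linked-trans {d} {d′} (linked (m , p , w) (k , q , u)) (linked (m′ , p′ , w′) (k′ , q′ , u′)) = linked
    (m + m′ , ℕ.+-mono-≤ p p′ , Walk-++ w w′)
    (k′ + k , ℕ.≤-trans (ℕ.+-mono-≤ q′ q) (ℕ.≤-reflexive (ℕ.+-comm d′ d)) , Walk-++ u′ u)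

  Linked-≤ : ∀ {d d′ r s} → d ≤ d′ → Linked d r s → Linked d′ r s
  Linked-≤ d≤ (linked (m , p , w) (k , q , u)) =
    linked (m , ℕ.≤-trans p d≤ , w) (k , ℕ.≤-trans q d≤ , u)

  adjacent-linked : ∀ {r s} → Adjacent r s → Adjacent s r → Linked 1 r s
  adjacent-linked {r} {s} p q =
    linked (1 , ℕ.≤-refl , step p (stop (≋-refl s))) (1 , ℕ.≤-refl , step q (stop (≋-refl r)))

  Turn-linked : ∀ {L L′ p} (v : Valid L) (v′ : Valid L′) → Turn L p L′ → Linked 1 ⟦ v ⟧ ⟦ v′ ⟧
  Turn-linked v v′ t = adjacent-linked
    (inj₁ (_ , Turn⇒Flip v v′ t)) (inj₁ (_ , Turn⇒Flip v′ v (Turn-sym t)))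

  Swap-linked : ∀ {L L′ i k e f} (v : Valid L) (v′ : Valid L′) → Swap L i k e f L′ →
                Linked 1 ⟦ v ⟧ ⟦ v′ ⟧
  Swap-linked v v′ s = adjacent-linked
    (inj₂ (_ , _ , _ , _ , Swap⇒Rotate v v′ s))
    (inj₂ (_ , _ , _ , _ , Swap⇒Rotate v′ v (Swap-sym s)))

  -- Touch counts and the turning of one segment

  touching? : ∀ L i j g → Dec (halt L j g ≡ just i)
  touching? L i j g = ≡-dec Fin._≟_ (halt L j g) (just i)

  touching : Layout → Fin n → Fin n → End → ℕ
  touching L i j g = indicator (touching? L i j g)

  touchCount : Layout → Fin n → ℕ
  touchCount L i = sum (λ j → touching L i j low + touching L i j high)

  horizontals : Layout → ℕ
  horizontals L = sum (λ j → indicator (ax L j ≟ᴬ horizontal))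

  -- A rotation brings no new end onto `i`: the end that moves inwards is that of `i` itself and
  -- goes to `k`, while the `f`-end of `k` leaves for a place beyond `i`.
  Swap-touchCount : ∀ {L i k e f L′} → Swap L i k e f L′ → touchCount L′ i < touchCount L i
  Swap-touchCount {L} {i} {k} {e} {f} {L′} s =
    sum-mono-< (λ j → ℕ.+-mono-≤ (fewer j low) (fewer j high)) k (at-k f strict)
    where
    open Swap s
    old : ∀ j g → halt L′ j g ≡ just i → halt L j g ≡ just i
    old j g p with (j Fin.≟ i) ×-dec (g ≟ᴱ e) | (j Fin.≟ k) ×-dec (g ≟ᴱ f)
    ... | yes (refl , refl) | _                 =
          contradiction (sym (just-injective (trans (sym halt-i′) p))) i≢k
    ... | no _              | yes (refl , refl) = halt-k
    ... | no q              | no r              = trans (sym (halt-same j g q r)) p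
    fewer : ∀ j g → touching L′ i j g ≤ touching L i j g
    fewer j g = indicator-mono (touching? L′ i j g) (touching? L i j g) (old j g)
    strict : touching L′ i k f < touching L i k f
    strict = indicator-< (touching? L′ i k f) (touching? L i k f)
      (λ p → <-irrefl (Eq.reflexive (cong (pos b f) p)) end<i) halt-k
    at-k : ∀ f → touching L′ i k f < touching L i k f →
           touching L′ i k low + touching L′ i k high < touching L i k low + touching L i k high
    at-k low  p = ℕ.+-mono-<-≤ p (fewer k high)
    at-k high p = ℕ.+-mono-≤-< (fewer k low) p

  TouchesFrom : Layout → Axis → End → Fin n → Fin n → Set ℓ₂
  TouchesFrom L a e i j = (halt L j low ≡ just i ⊎ halt L j high ≡ just i) × co a j <[ e ] co a i

  nearest-touching : ∀ L a e i →
    (∃[ k ] TouchesFrom L a e i k × (∀ j → TouchesFrom L a e i j → co a k ≤[ e ] co a j))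
    ⊎ (∀ j → ¬ TouchesFrom L a e i j)
  nearest-touching L a e i = least
    {_≼_ = λ x y → co a x ≤[ e ] co a y}
    (λ x y → ≤-total e (co a x) (co a y)) ≤-trans
    (λ j → (touching? L i j low ⊎-dec touching? L i j high) ×-dec <[]? e (co a j) (co a i))

  touches-at : ∀ {L i j} g → halt L j g ≡ just i → halt L j low ≡ just i ⊎ halt L j high ≡ just i
  touches-at low  p = inj₁ p
  touches-at high p = inj₂ p

  at-touch : ∀ {L i j} → halt L j low ≡ just i ⊎ halt L j high ≡ just i → ∃[ g ] halt L j g ≡ just i
  at-touch (inj₁ p) = low , p
  at-touch (inj₂ p) = high , p

  -- Distinct coordinates put each segment ending on `i` strictly on one side of `P i`, and the
  -- outermost one on that side meets the hypothesis of `MakeSwap`.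
  release : ∀ {L a b} (v : Valid L) i → a ⟂ b → ax L i ≡ a →
            (∃[ k ] ∃[ e ] ∃[ f ] ∃[ L′ ] Swap L i k e f L′ × Valid L′ × ax L′ ≡ ax L)
            ⊎ (∀ j g → halt L j g ≢ just i)
  release {L} {a} {b} v i a⟂b ax-i with nearest-touching L a low i | nearest-touching L a high i
  ... | inj₂ none | inj₂ none′ = inj₂ untouched
    where
    untouched : ∀ j g → halt L j g ≢ just i
    untouched j g p with <-compare low (co a j) (co a i)
    ... | tri< q _ _ = none j (touches-at {L} g p , q)
    ... | tri> _ _ q = none′ j (touches-at {L} g p , <-flip q)
    ... | tri≈ _ q _ with co-injective a q
    -- The remaining candidate is `i` itself, which cannot end on `i`, as ends halt at perpendicular
    -- segments.
    ...   | refl = ⟂⇒≢ a⟂b (trans (sym ax-i) (proj₁ (lands v i i a⟂b ax-i p)))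
  ... | inj₁ (k , (t , k<i) , near) | _ with at-touch {L} t
  ...   | f , halt-k = inj₁ (k , low , f , M.swapped , M.isSwap , M.swapped-valid , refl)
    where module M = MakeSwap v i k low f a⟂b ax-i halt-k k<i (λ j g p q → near j (touches-at {L} g p , q))
  release {L} {a} {b} v i a⟂b ax-i | inj₂ _ | inj₁ (k , (t , k<i) , near) with at-touch {L} t
  ...   | f , halt-k = inj₁ (k , high , f , M.swapped , M.isSwap , M.swapped-valid , refl)
    where module M = MakeSwap v i k high f a⟂b ax-i halt-k k<i (λ j g p q → near j (touches-at {L} g p , q))

  record Turned (d : ℕ) {L : Layout} (v : Valid L) (i : Fin n) (b : Axis) : Set (c ⊔ ℓ₁ ⊔ ℓ₂) where
    field
      {target}  : Layout
      valid     : Valid target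
      ax-turned : ax target i ≡ b
      ax-others : ∀ j → j ≢ i → ax target j ≡ ax L j
      path      : Linked d ⟦ v ⟧ ⟦ valid ⟧

  -- The bound `t` is the recursion argument: each rotation lowers the count by at least one, and
  -- `suc` pays for the final flip.
  turn : ∀ t {L a b} (v : Valid L) i → a ⟂ b → ax L i ≡ a → touchCount L i ≤ t → Turned (suc t) v i b
  turn t v i a⟂b ax-i count≤t with release v i a⟂b ax-i
  ... | inj₂ untouched = record
    { valid = M.turned-valid ; ax-turned = M.ax-p′ ; ax-others = M.ax-same
    ; path = Linked-≤ (s≤s z≤n) (Turn-linked v M.turned-valid M.isTurn) }
    where module M = MakeTurn v i a⟂b ax-i untouched
  turn zero v i a⟂b ax-i count≤t | inj₁ (k , e , f , L′ , s , v′ , ax≡) =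
    contradiction (ℕ.<-≤-trans (Swap-touchCount s) count≤t) λ ()
  turn (suc t) v i a⟂b ax-i count≤t | inj₁ (k , e , f , L′ , s , v′ , refl) = record
    { valid = T.valid ; ax-turned = T.ax-turned ; ax-others = T.ax-others
    ; path = Linked-trans (Swap-linked v v′ s) T.path }
    where
    module T = Turned (turn t v′ i a⟂b ax-i (s≤s⁻¹ (ℕ.≤-trans (Swap-touchCount s) count≤t)))

  sum-touchCount-≤ : ∀ L → sum (touchCount L) ≤ n * 2
  sum-touchCount-≤ L = begin
    sum (touchCount L)
      ≡⟨ ∑-comm (λ i j → touching L i j low + touching L i j high) ⟩
    sum (λ j → sum (λ i → touching L i j low + touching L i j high))
      ≤⟨ sum-≤-const 2 (λ j → ℕ.≤-trans
           (ℕ.≤-reflexive (∑-distrib-+ (λ i → touching L i j low) (λ i → touching L i j high)))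
           (ℕ.+-mono-≤ (one j low) (one j high))) ⟩
    n * 2 ∎
    where
    open ℕ.≤-Reasoning
    one : ∀ j g → sum (λ i → touching L i j g) ≤ 1
    one j g = sum-indicator-≤1 (λ i → touching? L i j g)
      (λ i k p q → just-injective (trans (sym p) q))

  least-touched : ∀ L i → (∀ j → ax L j ≡ horizontal → touchCount L i ≤ touchCount L j) →
                  horizontals L * touchCount L i ≤ n * 2
  least-touched L i min = begin
    horizontals L * touchCount L i
      ≡⟨ *-distribʳ-sum (touchCount L i) (λ j → indicator (ax L j ≟ᴬ horizontal)) ⟩
    sum (λ j → indicator (ax L j ≟ᴬ horizontal) * touchCount L i)
      ≤⟨ sum-mono-≤ (λ j → term j (ax L j ≟ᴬ horizontal)) ⟩
    sum (touchCount L)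
      ≤⟨ sum-touchCount-≤ L ⟩
    n * 2 ∎
    where
    open ℕ.≤-Reasoning
    term : ∀ j (d : Dec (ax L j ≡ horizontal)) → indicator d * touchCount L i ≤ touchCount L j
    term j (yes p) = ℕ.≤-trans (ℕ.≤-reflexive (ℕ.*-identityˡ (touchCount L i))) (min j p)
    -- Vertical segments contribute nothing on the left and can only enlarge the right.
    term j (no _)  = z≤n

  Turned-horizontals : ∀ {d L} {v : Valid L} {i} → ax L i ≡ horizontal → (T : Turned d v i vertical) →
                       horizontals (Turned.target T) < horizontals L
  Turned-horizontals {L = L} {i = i} p T = sum-mono-<
    (λ j → indicator-mono (ax target j ≟ᴬ horizontal) (ax L j ≟ᴬ horizontal) (old j)) i
    (indicator-< (ax target i ≟ᴬ horizontal) (ax L i ≟ᴬ horizontal) (λ q → v≢h (trans (sym ax-turned) q)) p)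
    where
    open Turned T
    v≢h : vertical ≢ horizontal
    v≢h ()
    old : ∀ j → ax target j ≡ horizontal → ax L j ≡ horizontal
    old j q with j Fin.≟ i
    ... | yes refl = p
    ... | no j≢i   = trans (sym (ax-others j j≢i)) q

  record Straightened (d : ℕ) {L : Layout} (v : Valid L) : Set (c ⊔ ℓ₁ ⊔ ℓ₂) where
    field
      {target} : Layout
      valid    : Valid target
      vertical-only : ∀ j → ax target j ≡ vertical
      path     : Linked d ⟦ v ⟧ ⟦ valid ⟧

  Straightened-≤ : ∀ {d d′ L} {v : Valid L} → d ≤ d′ → Straightened d v → Straightened d′ v
  Straightened-≤ p s = record { valid = valid ; vertical-only = vertical-only ; path = Linked-≤ p path }
    where open Straightened s

  -- The recursion runs on an upper bound, since a turn is recorded only as lowering the number of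
  -- horizontal segments; a bound that is not attained is lowered without any move.
  straighten : ∀ h {L} (v : Valid L) → horizontals L ≤ h → Straightened (harmonic (n * 2) h + h) v
  straighten h {L} v bound with least {_≼_ = λ i j → touchCount L i ≤ touchCount L j}
    (λ i j → ℕ.≤-total (touchCount L i) (touchCount L j)) ℕ.≤-trans (λ j → ax L j ≟ᴬ horizontal)
  ... | inj₂ none = record
    { valid = v ; vertical-only = λ j → by j (⟂-cases h⟂v (ax L j)) ; path = Linked-≤ z≤n Linked-refl }
    where
    by : ∀ j → ax L j ≡ horizontal ⊎ ax L j ≡ vertical → ax L j ≡ vertical
    by j (inj₁ p) = contradiction p (none j)
    by j (inj₂ p) = p
  straighten zero {L} v bound | inj₁ (i , p , _) =
    contradiction (ℕ.<-≤-trans (Turned-horizontals p (turn (touchCount L i) v i h⟂v p ℕ.≤-refl)) bound) λ ()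
  straighten (suc h) {L} v bound | inj₁ (i , p , min) with ℕ.m≤n⇒m<n∨m≡n bound
  ... | inj₁ fewer = Straightened-≤
        (ℕ.+-mono-≤ (ℕ.m≤n+m (harmonic (n * 2) h) (n * 2 / suc h)) (ℕ.n≤1+n h))
        (straighten h v (s≤s⁻¹ fewer))
  -- With equality, `suc h` is the true number of horizontal segments, so the averaging bound
  -- `least-touched` may be divided by it.
  ... | inj₂ exact = record
    { valid = S.valid ; vertical-only = S.vertical-only
    ; path = Linked-≤ enough (Linked-trans T.path S.path) }
    where
    t = touchCount L i
    T = turn t v i h⟂v p ℕ.≤-refl
    module T = Turned T
    module S = Straightened (straighten h T.valid
      (s≤s⁻¹ (ℕ.≤-trans (Turned-horizontals p T) bound)))
    open ℕ.≤-Reasoning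
    t≤ : t ≤ n * 2 / suc h
    t≤ = begin
      t                          ≡⟨ m*n/n≡m t (suc h) ⟨
      t * suc h / suc h          ≡⟨ cong (_/ suc h) (ℕ.*-comm t (suc h)) ⟩
      suc h * t / suc h          ≡⟨ cong (λ m → m * t / suc h) exact ⟨
      horizontals L * t / suc h  ≤⟨ /-monoˡ-≤ (suc h) (least-touched L i min) ⟩
      n * 2 / suc h              ∎
    enough : suc t + (harmonic (n * 2) h + h) ≤ harmonic (n * 2) (suc h) + suc h
    enough = begin
      suc t + (harmonic (n * 2) h + h)              ≡⟨ shuffle t (harmonic (n * 2) h) h ⟩
      t + harmonic (n * 2) h + suc h
        ≤⟨ ℕ.+-monoˡ-≤ (suc h) (ℕ.+-monoˡ-≤ (harmonic (n * 2) h) t≤) ⟩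
      n * 2 / suc h + harmonic (n * 2) h + suc h    ∎
      where
      shuffle : ∀ x y z → suc x + (y + z) ≡ x + y + suc z
      shuffle = solve-∀

  -- Uniqueness of the vertical rectangulation and the diameter

  vertical-unique : ∀ {L L′} (v : Valid L) (v′ : Valid L′) →
                    (∀ j → ax L j ≡ vertical) → (∀ j → ax L′ j ≡ vertical) → ⟦ v ⟧ ≋ ⟦ v′ ⟧
  vertical-unique {L} {L′} v v′ p p′ j =
    segment-cong v′ v j (trans (p j) (sym (p′ j))) (λ g → trans (free v p j g) (sym (free v′ p′ j g)))
    where
    free : ∀ {L} (v : Valid L) → (∀ j → ax L j ≡ vertical) → ∀ j g → halt L j g ≡ nothing
    free {L} v p j g with halt L j g in eq
    ... | nothing = refl
    -- An end halts only at a perpendicular segment, and there is none.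
    ... | just k with trans (sym (p k)) (proj₁ (lands v j k v⟂h (p j) eq))
    ...   | ()

  diameter : DiameterAtMost R P (cost n + cost n)
  diameter r r′ = join S.path S′.path
    where
    module A  = Read r
    module A′ = Read r′
    few : ∀ L → horizontals L ≤ n
    few L = ℕ.≤-trans (sum-≤-const 1 (λ j → indicator-≤1 (ax L j ≟ᴬ horizontal)))
                      (ℕ.≤-reflexive (ℕ.*-identityʳ n))
    module S  = Straightened (straighten n A.read-valid (few A.readLayout))
    module S′ = Straightened (straighten n A′.read-valid (few A′.readLayout))
    join : Linked (cost n) ⟦ A.read-valid ⟧ ⟦ S.valid ⟧ →
           Linked (cost n) ⟦ A′.read-valid ⟧ ⟦ S′.valid ⟧ →
           ∃[ m ] m ≤ cost n + cost n × Walk m r r′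
    join (linked (m , p , w) _) (linked _ (m′ , p′ , w′)) = m + m′ , ℕ.+-mono-≤ p p′ ,
      Walk-++ (Walk-respˡ r ⟦ A.read-valid ⟧ A.read-≋ w)
        (Walk-respˡ ⟦ S.valid ⟧ ⟦ S′.valid ⟧
          (vertical-unique S.valid S′.valid S.vertical-only S′.vertical-only)
          (Walk-≋ w′))
      where
      Walk-≋ : ∀ {m s} → Walk m s ⟦ A′.read-valid ⟧ → Walk m s r′
      Walk-≋ {s = s} (stop q) =
        stop (≋-trans s ⟦ A′.read-valid ⟧ r′ q (≋-sym r′ ⟦ A′.read-valid ⟧ A′.read-≋))
      Walk-≋ (step q w) = step q (Walk-≋ w)

theorem1 : ∀ {c ℓ₁ ℓ₂} →
    ∃[ C ] 0 < C × (∀ (K : StrictTotalOrder c ℓ₁ ℓ₂) → let open Plane K in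
    ∀ (n : ℕ) → 2 ≤ n → (R : Rectangle) (P : Fin n → Point) →
    Noncorectilinear P → (∀ i → P i ∈ᴿ° R) →
    DiameterAtMost R P (C * n * ⌊log₂ n ⌋))
theorem1 = 10 , s≤s z≤n , λ K n 2≤n R P P-apart P∈R r r′ →
  let m , m≤ , w = Rectangulations.diameter K R P P-apart P∈R r r′
  in m , ℕ.≤-trans m≤ (cost-≤ n 2≤n) , w
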